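{- Let $n\in\mathbb{N}$ and let $A$ be an $n\times n$ acyclic real symmetric matrix. Suppose $\lambda$ is an eigenvalue of $A$ of multiplicity $k$ and $U=\{u_1,\ldots,u_k\}$ is a $\lambda$-star set of $A$. For $i\in[k]$ let $U_i=U\setminus\{u_i\}$ and let $A_i$ be the principal submatrix of $A-U_i$ corresponding to the connected component of $G(A-U_i)$ containing $u_i$. Define $\boldsymbol{\alpha}_i\in\mathbb{R}^n$ by \[ \boldsymbol{\alpha}_i(v)=\begin{cases} W(P_{u_i,v})\,\phi(A_i-P_{u_i,v},\lambda) & \text{if } v \text{ is an index of } A_i,\\ 0 & \text{otherwise}.\end{cases} \] Then $\boldsymbol{\alpha}_1,\ldots,\boldsymbol{\alpha}_k$ are $k$ linearly independent $\lambda$-eigenvectors of $A$.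
   Context: $[n]=\{1,\ldots,n\}$. For a real symmetric matrix $A$ with rows/columns indexed by a set $I$, its graph $G(A)$ has vertex set $I$, with $u\neq v$ adjacent iff $A_{uv}\neq 0$; edge $uv$ has weight $w(uv)=A_{uv}$. $A$ is called acyclic if $G(A)$ is a forest. For $u,v$ in the same component, $P_{u,v}$ is the unique path between them (a single vertex if $u=v$), and $W(P_{u,v})$ is the product of the weights of its edges ($1$ if $u=v$). For an index set $U$, $A-U$ is the matrix obtained by deleting the rows and columns indexed by $U$. $\phi(B,\lambda)=\det(\lambda\mathbb{I}-B)$, with $\phi$ of the empty matrix equal to $1$. If $\lambda$ is an eigenvalue of $A$ of multiplicity $k$, a set $U$ of indices is a $\lambda$-star set if $|U|=k$ and $\lambda$ is not an eigenvalue of $A-U$. -}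

module Defs where

open import Algebra.Bundles using (CommutativeRing)
open import Data.Bool.Base using (true; false)
open import Data.Fin.Base using (Fin; zero; suc; toℕ; punchIn)
open import Data.Fin.Properties using (any?) renaming (_≟_ to _≟ᶠ_)
open import Data.Fin.Subset
  using (Subset; _∈_; _∪_; _─_; _⊂_; ∁; ∣_∣; ⁅_⁆) renaming (⊤ to full; _-_ to _∖_)
open import Data.Fin.Subset.Induction using (⊂-wellFounded)
open import Data.Fin.Subset.Properties using (_∈?_; x∈p⇒p-x⊂p)
open import Data.Nat.Base as ℕ using (ℕ)
open import Data.Product.Base using (∃; _×_; _,_)
open import Data.Vec.Base using ([]; _∷_; tabulate)
open import Function.Bundles using (_⇔_)
open import Function.Definitions using (Injective)
open import Induction.WellFounded using (Acc; acc)
open import Level using (0ℓ) renaming (suc to lsuc)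
open import Relation.Binary.Core using (Rel)
open import Relation.Binary.Definitions using () renaming (Decidable to Decidable₂)
open import Relation.Binary.PropositionalEquality using (_≡_; _≢_)
open import Relation.Binary.Structures using (IsDecTotalOrder)
open import Relation.Nullary.Decidable using (Dec; yes; no; does; ¬?; _×-dec_)
open import Relation.Nullary.Negation using (¬_)
import Algebra.Properties.Semiring.Exp
import Algebra.Properties.Semiring.Sum

-- The classical real numbers, as a Dedekind-complete ordered field (hence
-- determined up to isomorphism).  The order is decidable, as it is
-- classically; constructively no closed inhabitant can be exhibited.
record RealNumbers : Set (lsuc 0ℓ) where
  field
    commutativeRing : CommutativeRing 0ℓ 0ℓ

  open CommutativeRing commutativeRing public renaming (Carrier to ℝ)

  infix 4 _≤_
  field
    _≤_             : Rel ℝ 0ℓ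
    isDecTotalOrder : IsDecTotalOrder _≈_ _≤_
    1≉0             : ¬ (1# ≈ 0#)
    inverse         : ∀ x → ¬ (x ≈ 0#) → ∃ λ y → x * y ≈ 1#
    +-monoˡ-≤       : ∀ {x y} z → x ≤ y → x + z ≤ y + z
    *-nonNegative   : ∀ {x y} → 0# ≤ x → 0# ≤ y → 0# ≤ x * y

  UpperBound : (ℝ → Set) → ℝ → Set
  UpperBound P b = ∀ x → P x → x ≤ b

  field
    complete : ∀ (P : ℝ → Set) → ∃ P → ∃ (UpperBound P) →
               ∃ λ s → UpperBound P s × (∀ b → UpperBound P b → s ≤ b)

  open IsDecTotalOrder isDecTotalOrder public using (_≟_; _≤?_)

module Paths {n : ℕ} (E : Rel (Fin n) 0ℓ) where

  -- Paths from u to v with all vertices in S.  A vertex is removed from the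
  -- admissible set when the path leaves it, so no vertex is repeated.
  data Path (S : Subset n) (u v : Fin n) : Set where
    stop : u ∈ S → u ≡ v → Path S u v
    step : (w : Fin n) → u ∈ S → E u w → Path (S ∖ u) w v → Path S u v

  length : ∀ {S u v} → Path S u v → ℕ
  length (stop _ _)     = 0
  length (step _ _ _ p) = ℕ.suc (length p)

  vertices : ∀ {S u v} → Path S u v → Subset n
  vertices {u = u} (stop _ _)     = ⁅ u ⁆
  vertices {u = u} (step _ _ _ p) = ⁅ u ⁆ ∪ vertices p

  -- A cycle is a path with at least three vertices whose ends are adjacent.
  Acyclic : Set
  Acyclic = ∀ {u v} (p : Path full u v) → 2 ℕ.≤ length p → ¬ E v u

  module _ (E? : Decidable₂ E) where

    search : ∀ S → Acc _⊂_ S → ∀ u v → Dec (Path S u v)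
    search S (acc rs) u v with u ∈? S
    ... | no  u∉S = no λ { (stop u∈S _) → u∉S u∈S ; (step _ u∈S _ _) → u∉S u∈S }
    ... | yes u∈S with u ≟ᶠ v
    ...   | yes u≡v = yes (stop u∈S u≡v)
    ...   | no  u≢v with any? (λ w → E? u w ×-dec search (S ∖ u) (rs (x∈p⇒p-x⊂p u∈S)) w v)
    ...     | yes (w , e , p) = yes (step w u∈S e p)
    ...     | no  none        = no λ { (stop _ u≡v)     → u≢v u≡v
                                     ; (step w _ e p) → none (w , e , p) }

    path? : ∀ S u v → Dec (Path S u v)
    path? S = search S (⊂-wellFounded S)

    -- The vertex set of the component of u in the subgraph induced on S.
    component : Subset n → Fin n → Subset n
    component S u = tabulate λ v → does (path? S u v)

-- The increasing enumeration of a subset.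
elements : ∀ {n} (S : Subset n) → Fin ∣ S ∣ → Fin n
elements (true  ∷ S) zero    = zero
elements (true  ∷ S) (suc i) = suc (elements S i)
elements (false ∷ S) i       = suc (elements S i)

record Enumerates {n k : ℕ} (u : Fin k → Fin n) (U : Subset n) : Set where
  field
    injective : Injective _≡_ _≡_ u
    image     : ∀ v → v ∈ U ⇔ ∃ λ i → u i ≡ v

module Spectral (R : RealNumbers) where

  open RealNumbers R hiding (zero)
  open Algebra.Properties.Semiring.Exp semiring using (_^_)
  open Algebra.Properties.Semiring.Sum semiring using (sum)

  Vector : ℕ → Set
  Vector n = Fin n → ℝ

  Matrix : ℕ → Set
  Matrix n = Fin n → Fin n → ℝ

  Symmetric : ∀ {n} → Matrix n → Set
  Symmetric A = ∀ i j → A i j ≈ A j i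

  identity : ∀ {n} → Matrix n
  identity i j with i ≟ᶠ j
  ... | yes _ = 1#
  ... | no  _ = 0#

  -- Laplace expansion along the first row.
  det : ∀ {n} → Matrix n → ℝ
  det {ℕ.zero}  M = 1#
  det {ℕ.suc n} M =
    sum λ j → (- 1#) ^ toℕ j * M zero j * det (λ r c → M (suc r) (punchIn j c))

  φ : ∀ {n} → Matrix n → ℝ → ℝ
  φ B t = det λ i j → t * identity i j - B i j

  infix 8 _[_]
  _[_] : ∀ {n} → Matrix n → (S : Subset n) → Matrix ∣ S ∣
  (A [ S ]) i j = A (elements S i) (elements S j)

  delete : ∀ {n} → Matrix n → (U : Subset n) → Matrix ∣ ∁ U ∣
  delete A U = A [ ∁ U ]

  Eigenspace : ∀ {n} → Matrix n → ℝ → Vector n → Set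
  Eigenspace A t x = ∀ i → sum (λ j → A i j * x j) ≈ t * x i

  IsEigenvector : ∀ {n} → Matrix n → ℝ → Vector n → Set
  IsEigenvector A t x = Eigenspace A t x × ¬ (∀ i → x i ≈ 0#)

  IsEigenvalue : ∀ {n} → Matrix n → ℝ → Set
  IsEigenvalue A t = ∃ (IsEigenvector A t)

  combination : ∀ {k n} → Vector k → (Fin k → Vector n) → Vector n
  combination c x v = sum λ i → c i * x i v

  LinearlyIndependent : ∀ {k n} → (Fin k → Vector n) → Set
  LinearlyIndependent {k} x =
    ∀ (c : Vector k) → (∀ v → combination c x v ≈ 0#) → ∀ i → c i ≈ 0#

  -- The eigenspace has dimension k.  For symmetric matrices this is also the
  -- multiplicity of t as a root of the characteristic polynomial.
  record HasMultiplicity {n} (A : Matrix n) (t : ℝ) (k : ℕ) : Set where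
    field
      basis       : Fin k → Vector n
      inside      : ∀ i → Eigenspace A t (basis i)
      independent : LinearlyIndependent basis
      spanning    : ∀ x → Eigenspace A t x → ∃ λ c → ∀ v → x v ≈ combination c basis v

  -- For an eigenvalue t of A of multiplicity k.
  IsStarSet : ∀ {n} → Matrix n → ℝ → ℕ → Subset n → Set
  IsStarSet A t k U = ∣ U ∣ ≡ k × ¬ IsEigenvalue (delete A U) t

  module _ {n : ℕ} (A : Matrix n) where

    Adjacent : Rel (Fin n) 0ℓ
    Adjacent u v = u ≢ v × ¬ (A u v ≈ 0#)

    adjacent? : Decidable₂ Adjacent
    adjacent? u v = ¬? (u ≟ᶠ v) ×-dec ¬? (A u v ≟ 0#)

    open Paths Adjacent

    AcyclicMatrix : Set
    AcyclicMatrix = Acyclic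

    weight : ∀ {S u v} → Path S u v → ℝ
    weight         (stop _ _)     = 1#
    weight {u = u} (step w _ _ p) = A u w * weight p

    -- S indexes a principal submatrix of A and C is the component of u in its
    -- graph, so a path from u to v in S stays in C, it exists exactly when v
    -- is in C, and it is unique when A is acyclic.
    pathVector : ℝ → Subset n → Fin n → Vector n
    pathVector t S u v with path? adjacent? S u v
    ... | yes p = weight p * φ (A [ C ─ vertices p ]) t
      where C = component adjacent? S u
    ... | no  _ = 0#

    α : ∀ {k} → ℝ → Subset n → (Fin k → Fin n) → Fin k → Vector n
    α t U u i = pathVector t (∁ (U ∖ u i)) (u i)

{-# OPTIONS --safe #-}

-- Write M = t I - A and ψ(K) = det M[K].  Since A is acyclic, ψ satisfies
--   ψ(K) = M_ww ψ(K - w) - Σ_v M_wv M_vw ψ(K - w - v)   for every w in K,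
-- because ψ is a signed sum over the matchings of the forest.  Applied at w to
-- the vertices beyond the path from uᵢ to the predecessor of w, this identity
-- says that M αᵢ vanishes in row w, for every w outside U.  As t is not an
-- eigenvalue of A - U, an eigenvector is determined by its values on U, so by
-- dimension there is one, x, with prescribed values on U; choosing x = αᵢ on U,
-- the difference αᵢ - x vanishes on U and is a null vector of M outside U, hence
-- is 0 and αᵢ = x.  Finally αᵢ vanishes at the other points of U, and αᵢ(uᵢ) =
-- ψ(Cᵢ - uᵢ) ≠ 0 since Cᵢ - uᵢ is a union of components of the graph of A - U;
-- this gives independence.

module Submission where

open import Defs
open import Data.Nat.Base using (ℕ)
open import Data.Fin.Base using (Fin)
open import Data.Fin.Subset using (Subset)
open import Data.Product.Base using (_×_)

open import Data.Bool.Base using (Bool; true; false; if_then_else_)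
open import Data.Fin.Base using (zero; suc; toℕ; punchIn; cast)
open import Data.Fin.Properties using (any?; cast-is-id; punchInᵢ≢i; suc-injective) renaming (_≟_ to _≟ᶠ_)
open import Data.Fin.Subset
  using (_∈_; _∉_; _⊆_; ∣_∣; ⁅_⁆; _∪_; _─_; ∁) renaming (_-_ to _∖_; ⊤ to full)
open import Data.Fin.Subset.Properties
  using ( p─⊥≡p; p─x─y≡p─y─x; x∈p∧x≢y⇒x∈p-y; p─q⊆p; p─q─r≡p─q∪r; ∈⊤; _∈?_; drop-there
        ; x∈∁p⇒x∉p; x∉p⇒x∈∁p; x∉∁p⇒x∈p)
open import Data.Nat.Base as ℕ using (pred; s≤s; z≤n)
open import Data.Product.Base using (∃; _,_; proj₁; proj₂)
open import Data.Vec.Base using ([]; _∷_; here; there)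
open import Data.Vec.Functional using (insertAt)
open import Data.Vec.Functional.Properties using (insertAt-lookup; insertAt-punchIn)
open import Data.Vec.Properties using (lookup∘tabulate; lookup⇒[]=; []=⇒lookup)
open import Function.Base using (_∘_; id)
open import Function.Bundles using (Equivalence; mk⇔)
open import Level using (0ℓ)
open import Relation.Binary.Core using (Rel)
open import Relation.Binary.PropositionalEquality as ≡ using (_≡_; _≢_)
open import Relation.Nullary.Decidable
  using (Dec; does; yes; no; ¬?; decidable-stable; dec-true; dec-false; does-⇔)
open import Relation.Nullary.Negation using (¬_; contradiction)
import Algebra.Properties.CommutativeMonoid.Sum
import Algebra.Properties.Ring
import Algebra.Properties.Semiring.Exp
import Algebra.Properties.Semiring.Sum
import Algebra.Solver.Ring.NaturalCoefficients.Default
import Data.Bool.Properties as Bool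
import Data.Nat.Properties as ℕ
import Relation.Binary.Reasoning.Setoid

-- The determinant is given only by expansion along the first row, so the formula for forests is
-- reached without permutations. Expanding along row 0 and then along column 0 yields products of an
-- entry `N zero (suc j)`, an entry `N (suc r) zero` and a minor. For `j ≢ r` one of the three is
-- zero: if both entries are nonzero, `j` and `r` lie in different components once vertex 0 is
-- removed, and counting vertices on one side kills the minor. The detour through dimension is
-- forced by the rows in `U`: in row uᵢ the matching identity yields ψ(Cᵢ), and that this is 0
-- depends on the multiplicity. The linear algebra rests on a single fact, that a singular matrix
-- has a nonzero null vector.

count : ∀ {n} → (Fin n → Bool) → ℕ
count p = Algebra.Properties.CommutativeMonoid.Sum.sum ℕ.+-0-commutativeMonoid
            λ i → if p i then 1 else 0

count-punchIn : ∀ {n} (p : Fin (ℕ.suc n) → Bool) i →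
                count p ≡ (if p i then 1 else 0) ℕ.+ count (p ∘ punchIn i)
count-punchIn p i =
  Algebra.Properties.CommutativeMonoid.Sum.sum-remove ℕ.+-0-commutativeMonoid
    {i = i} λ i → if p i then 1 else 0

-- Determinants by Laplace expansion.

module Determinant (R : RealNumbers) where

  open RealNumbers R hiding (zero)
  open Spectral R
  open Algebra.Properties.Ring ring using (-‿involutive; -1*x≈-x)
  open Algebra.Properties.Semiring.Exp semiring using (_^_)
  open Algebra.Properties.Semiring.Sum semiring
    using (sum; sum-cong-≋; sum-remove; sum-replicate-zero; ∑-comm; ∑-distrib-+; *-distribˡ-sum)
  open Algebra.Solver.Ring.NaturalCoefficients.Default commutativeSemiring
    using (solve; _:+_; _:*_; _:=_; con)
  open Relation.Binary.Reasoning.Setoid setoid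

  sum-zero : ∀ {n} {f : Vector n} → (∀ i → f i ≈ 0#) → sum f ≈ 0#
  sum-zero {n} f≈0 = trans (sum-cong-≋ f≈0) (sum-replicate-zero n)

  sum-scale : ∀ {n} c {f g : Vector n} → (∀ i → f i ≈ c * g i) → sum f ≈ c * sum g
  sum-scale c {f} {g} f≈cg = trans (sum-cong-≋ f≈cg) (sym (*-distribˡ-sum c g))

  sum-linear : ∀ {n} (a x y : Vector n) c d →
    sum (λ v → a v * (c * x v + d * y v)) ≈ c * sum (λ v → a v * x v) + d * sum (λ v → a v * y v)
  sum-linear {n} a x y c d = begin
    sum (λ v → a v * (c * x v + d * y v))
      ≈⟨ sum-cong-≋ {n} (λ v → solve 5 (λ a c x d y → a :* (c :* x :+ d :* y) := c :* (a :* x) :+ d :* (a :* y))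
           refl (a v) c (x v) d (y v)) ⟩
    sum (λ v → c * (a v * x v) + d * (a v * y v))
      ≈⟨ ∑-distrib-+ (λ v → c * (a v * x v)) (λ v → d * (a v * y v)) ⟩
    sum (λ v → c * (a v * x v)) + sum (λ v → d * (a v * y v))
      ≈⟨ +-cong (*-distribˡ-sum c (λ v → a v * x v)) (*-distribˡ-sum d (λ v → a v * y v)) ⟨
    c * sum (λ v → a v * x v) + d * sum (λ v → a v * y v) ∎

  zero-middle : ∀ {a b c} → b ≈ 0# → a * b * c ≈ 0#
  zero-middle {a} {b} {c} b≈0 = trans (*-congʳ (trans (*-congˡ b≈0) (zeroʳ a))) (zeroˡ c)

  -- Signs are written as factors `- 1#`, which the semiring identities given to `solve` treat as an
  -- indeterminate; cancellation is then left to this lemma.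
  x+-1*x≈0 : ∀ x → x + - 1# * x ≈ 0#
  x+-1*x≈0 x = trans (+-congˡ (-1*x≈-x x)) (-‿inverseʳ x)

  cancel-≉0 : ∀ {a b} → ¬ a ≈ 0# → a * b ≈ 0# → b ≈ 0#
  cancel-≉0 {a} {b} a≉0 ab≈0 with inverse a a≉0
  ... | a⁻¹ , aa⁻¹≈1 = begin
    b               ≈⟨ *-identityˡ b ⟨
    1# * b          ≈⟨ *-congʳ aa⁻¹≈1 ⟨
    a * a⁻¹ * b     ≈⟨ solve 3 (λ x y z → x :* y :* z := y :* (x :* z)) refl a a⁻¹ b ⟩
    a⁻¹ * (a * b)   ≈⟨ *-congˡ ab≈0 ⟩
    a⁻¹ * 0#        ≈⟨ zeroʳ _ ⟩
    0#              ∎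

  sgn : ∀ {n} → Fin n → ℝ
  sgn i = (- 1#) ^ toℕ i

  -1*-1*x≈x : ∀ x → - 1# * (- 1# * x) ≈ x
  -1*-1*x≈x x = begin
    - 1# * (- 1# * x)  ≈⟨ -1*x≈-x _ ⟩
    - (- 1# * x)       ≈⟨ -‿cong (-1*x≈-x x) ⟩
    - (- x)            ≈⟨ -‿involutive x ⟩
    x                  ∎

  sgn*sgn : ∀ {n} (i : Fin n) → sgn i * sgn i ≈ 1#
  sgn*sgn zero    = *-identityˡ 1#
  sgn*sgn (suc i) = begin
    - 1# * sgn i * (- 1# * sgn i)   ≈⟨ solve 2 (λ m s → m :* s :* (m :* s) := m :* (m :* (s :* s))) refl (- 1#) (sgn i) ⟩
    - 1# * (- 1# * (sgn i * sgn i)) ≈⟨ -1*-1*x≈x _ ⟩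
    sgn i * sgn i                   ≈⟨ sgn*sgn i ⟩
    1#                              ∎

  minor : ∀ {m} → Matrix (ℕ.suc m) → (i j : Fin (ℕ.suc m)) → Matrix m
  minor N i j r c = N (punchIn i r) (punchIn j c)

  tail² : ∀ {m} → Matrix (ℕ.suc m) → Matrix m
  tail² N r c = N (suc r) (suc c)

  det-cong : ∀ {m} (M N : Matrix m) → (∀ i j → M i j ≈ N i j) → det M ≈ det N
  det-cong {ℕ.zero}  M N M≈N = refl
  det-cong {ℕ.suc m} M N M≈N = sum-cong-≋ {ℕ.suc m} λ j →
    *-cong (*-congˡ {sgn j} (M≈N zero j))
           (det-cong (minor M zero j) (minor N zero j) λ r c → M≈N (suc r) (punchIn j c))

  det-zero-row : ∀ {m} (N : Matrix (ℕ.suc m)) → (∀ j → N zero j ≈ 0#) → det N ≈ 0#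
  det-zero-row {m} N N₀≈0 = sum-zero {ℕ.suc m} λ j →
    zero-middle {sgn j} {N zero j} {det (minor N zero j)} (N₀≈0 j)

  firstColumn : ∀ {m} → Matrix (ℕ.suc m) → ℝ
  firstColumn N = sum λ i → sgn i * N i zero * det (minor N i zero)

  -- A term of the expansion along row 0 followed by column 0. Its sign is that of column `suc j`
  -- times that of row `r` of the minor; the shift from `j` to `suc j` gives the extra `- 1#`.
  crossTerm : ∀ {m} → Matrix (ℕ.suc (ℕ.suc m)) → Matrix (ℕ.suc m)
  crossTerm N j r =
    - 1# * (sgn j * sgn r) * (N zero (suc j) * N (suc r) zero * det (minor (tail² N) r j))

  crossTerms : ∀ {m} → Matrix (ℕ.suc (ℕ.suc m)) → ℝ
  crossTerms N = sum λ j → sum λ r → crossTerm N j r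

  -- Proved together with `det-cross` by induction on the size. The cross terms treat row 0 and
  -- column 0 alike, so exchanging the two sums turns the row expansion into the column expansion.
  det-column : ∀ {m} (N : Matrix (ℕ.suc m)) → det N ≈ firstColumn N

  det-cross : ∀ {m} (N : Matrix (ℕ.suc (ℕ.suc m))) →
              det N ≈ N zero zero * det (tail² N) + crossTerms N
  det-cross {m} N = +-cong (*-congʳ (*-identityˡ _)) (sum-cong-≋ {ℕ.suc m} λ j → begin
    - 1# * sgn j * N zero (suc j) * det (minor N zero (suc j))
      ≈⟨ *-congˡ (det-column (minor N zero (suc j))) ⟩
    - 1# * sgn j * N zero (suc j) * firstColumn (minor N zero (suc j))
      ≈⟨ sum-scale (- 1# * sgn j * N zero (suc j)) {g = λ r → sgn r * N (suc r) zero * det (minor (tail² N) r j)}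
           (λ r → solve 6 (λ m s a t b d →
              m :* (s :* t) :* (a :* b :* d) := m :* s :* a :* (t :* b :* d)) refl
              (- 1#) (sgn j) (N zero (suc j)) (sgn r) (N (suc r) zero) (det (minor (tail² N) r j))) ⟨
    sum (crossTerm N j)
      ∎)

  det-column {ℕ.zero}  N = refl
  det-column {ℕ.suc m} N = begin
    det N
      ≈⟨ det-cross N ⟩
    N zero zero * det (tail² N) + crossTerms N
      ≈⟨ +-cong (*-congʳ (sym (*-identityˡ _)))
           (trans (∑-comm {ℕ.suc m} {ℕ.suc m} (crossTerm N)) (sum-cong-≋ {ℕ.suc m} λ r →
             sum-scale (- 1# * sgn r * N (suc r) zero) {g = λ j → sgn j * N zero (suc j) * det (minor (tail² N) r j)}
               (λ j → solve 6 (λ m s a t b d →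
                  m :* (s :* t) :* (a :* b :* d) := m :* t :* b :* (s :* a :* d)) refl
                  (- 1#) (sgn j) (N zero (suc j)) (sgn r) (N (suc r) zero) (det (minor (tail² N) r j))))) ⟩
    firstColumn N ∎

  swapRows : ∀ {m} → Fin (ℕ.suc (ℕ.suc m)) → Fin (ℕ.suc (ℕ.suc m))
  swapRows zero          = suc zero
  swapRows (suc zero)    = zero
  swapRows (suc (suc i)) = suc (suc i)

  -- In the expansion along the first column, the terms of rows 0 and 1 trade places and hence
  -- signs. Every other minor still has the two rows in its first two places, so induction applies.
  det-swapRows : ∀ {m} (N : Matrix (ℕ.suc (ℕ.suc m))) → det (N ∘ swapRows) ≈ - 1# * det N
  det-swapRows {m} N = begin
    det (N ∘ swapRows)          ≈⟨ det-column (N ∘ swapRows) ⟩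
    firstColumn (N ∘ swapRows)  ≈⟨ +-cong (*-congˡ D₁) (+-cong (*-congˡ D₀) (sum-scale {m} (- 1#) (lower N))) ⟩
    1# * b * d₁ + (- 1# * 1# * a * d₀ + - 1# * s)
      ≈⟨ +-congʳ (-1*-1*x≈x _) ⟨
    - 1# * (- 1# * (1# * b * d₁)) + (- 1# * 1# * a * d₀ + - 1# * s)
      ≈⟨ solve 6 (λ m a b x y s → m :* (m :* (con 1 :* b :* y)) :+ (m :* con 1 :* a :* x :+ m :* s)
                  := m :* (con 1 :* a :* x :+ (m :* con 1 :* b :* y :+ s))) refl (- 1#) a b d₀ d₁ s ⟩
    - 1# * firstColumn N        ≈⟨ *-congˡ (det-column N) ⟨
    - 1# * det N                ∎
    where
    a = N zero zero
    b = N (suc zero) zero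
    d₀ = det (minor N zero zero)
    d₁ = det (minor N (suc zero) zero)
    s = sum λ i → sgn (suc (suc i)) * N (suc (suc i)) zero * det (minor N (suc (suc i)) zero)
    D₁ : det (minor (N ∘ swapRows) zero zero) ≈ d₁
    D₁ = det-cong (minor (N ∘ swapRows) zero zero) (minor N (suc zero) zero) λ { zero c → refl ; (suc r) c → refl }
    D₀ : det (minor (N ∘ swapRows) (suc zero) zero) ≈ d₀
    D₀ = det-cong (minor (N ∘ swapRows) (suc zero) zero) (minor N zero zero) λ { zero c → refl ; (suc r) c → refl }
    -- The size is quantified anew: an index `i` forces it to be a successor, so that the minor has
    -- two rows to swap.
    lower : ∀ {m} (N : Matrix (ℕ.suc (ℕ.suc m))) i →
            sgn (suc (suc i)) * N (suc (suc i)) zero * det (minor (N ∘ swapRows) (suc (suc i)) zero)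
            ≈ - 1# * (sgn (suc (suc i)) * N (suc (suc i)) zero * det (minor N (suc (suc i)) zero))
    lower {ℕ.suc m} N i = begin
      t * det (minor (N ∘ swapRows) (suc (suc i)) zero)
        ≈⟨ *-congˡ (det-cong (minor (N ∘ swapRows) (suc (suc i)) zero) (minor N (suc (suc i)) zero ∘ swapRows)
             λ { zero c → refl ; (suc zero) c → refl ; (suc (suc r)) c → refl }) ⟩
      t * det (minor N (suc (suc i)) zero ∘ swapRows)
        ≈⟨ *-congˡ (det-swapRows (minor N (suc (suc i)) zero)) ⟩
      t * (- 1# * det (minor N (suc (suc i)) zero))
        ≈⟨ solve 3 (λ t m d → t :* (m :* d) := m :* (t :* d)) refl t (- 1#) _ ⟩
      - 1# * (t * det (minor N (suc (suc i)) zero)) ∎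
      where t = sgn (suc (suc i)) * N (suc (suc i)) zero

  -- For adjacent rows 0 and 1, expansion along the first column leaves two
  -- equal minors with opposite signs.
  det-repeated : ∀ {m} (N : Matrix (ℕ.suc m)) (i : Fin m) →
                 (∀ c → N zero c ≈ N (suc i) c) → det N ≈ 0#
  det-repeated {ℕ.suc m} N zero N₀≈N₁ = begin
    det N          ≈⟨ det-column N ⟩
    firstColumn N  ≈⟨ +-congˡ (+-cong (*-cong (*-congˡ (sym (N₀≈N₁ zero))) D) (sum-zero {m} (lower N N₀≈N₁))) ⟩
    1# * a * d + (- 1# * 1# * a * d + 0#)
      ≈⟨ solve 3 (λ m a d → con 1 :* a :* d :+ (m :* con 1 :* a :* d :+ con 0) := a :* d :+ m :* (a :* d)) refl (- 1#) a d ⟩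
    a * d + - 1# * (a * d) ≈⟨ x+-1*x≈0 _ ⟩
    0# ∎
    where
    a = N zero zero
    d = det (minor N zero zero)
    D : det (minor N (suc zero) zero) ≈ d
    D = det-cong (minor N (suc zero) zero) (minor N zero zero) λ { zero c → N₀≈N₁ (suc c) ; (suc r) c → refl }
    lower : ∀ {m} (N : Matrix (ℕ.suc (ℕ.suc m))) → (∀ c → N zero c ≈ N (suc zero) c) → ∀ i →
            sgn (suc (suc i)) * N (suc (suc i)) zero * det (minor N (suc (suc i)) zero) ≈ 0#
    lower {ℕ.suc m} N N₀≈N₁ i =
      trans (*-congˡ (det-repeated (minor N (suc (suc i)) zero) zero λ c → N₀≈N₁ (suc c))) (zeroʳ _)
  -- After the swap, expansion along the new first row leaves minors that still contain both equal
  -- rows, the old row 0 now being first.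
  det-repeated {ℕ.suc m} N (suc i) N₀≈Nᵢ = begin
    det N                       ≈⟨ -1*-1*x≈x _ ⟨
    - 1# * (- 1# * det N)       ≈⟨ *-congˡ (det-swapRows N) ⟨
    - 1# * det (N ∘ swapRows)   ≈⟨ *-congˡ (sum-zero {ℕ.suc (ℕ.suc m)} λ j →
                                     trans (*-congˡ {sgn j * N (suc zero) j} (det-repeated (minor (N ∘ swapRows) zero j) i
                                       λ c → N₀≈Nᵢ (punchIn j c))) (zeroʳ _)) ⟩
    - 1# * 0#                   ≈⟨ zeroʳ _ ⟩
    0#                          ∎

  -- Null vectors of singular matrices.

  NullVector : ∀ {m n} → (Fin m → Fin n → ℝ) → Vector n → Set
  NullVector N x = (∀ i → sum (λ j → N i j * x j) ≈ 0#) × ∃ λ j → ¬ x j ≈ 0#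

  cofactor : ∀ {m} → Matrix (ℕ.suc m) → Vector (ℕ.suc m)
  cofactor N j = sgn j * det (minor N zero j)

  -- The sum is the determinant of `N` with row 0 replaced by row `i`: this is `N` itself or a
  -- matrix with a repeated row.
  *-cofactor : ∀ {m} (N : Matrix (ℕ.suc m)) i → det N ≈ 0# → sum (λ j → N i j * cofactor N j) ≈ 0#
  *-cofactor {m} N i det≈0 = trans (replaced i) (row i)
    where
    N[_] : Fin (ℕ.suc m) → Matrix (ℕ.suc m)
    N[ i ] zero    = N i
    N[ i ] (suc r) = N (suc r)
    replaced : ∀ i → sum (λ j → N i j * cofactor N j) ≈ det N[ i ]
    replaced i = sum-cong-≋ {ℕ.suc m} λ j →
      solve 3 (λ a s d → a :* (s :* d) := s :* a :* d) refl (N i j) (sgn j) (det (minor N zero j))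
    row : ∀ i → det N[ i ] ≈ 0#
    row zero    = trans (det-cong N[ zero ] N λ { zero c → refl ; (suc r) c → refl }) det≈0
    row (suc i) = det-repeated N[ suc i ] i λ c → refl

  -- If all cofactors of the first row vanish, there are two independent
  -- vectors killed by the remaining rows, and a combination of the two is
  -- also killed by the first row.
  singular⇒null : ∀ {m} (N : Matrix m) → det N ≈ 0# → ∃ (NullVector N)
  singular⇒null {ℕ.zero}  N 1≈0   = contradiction 1≈0 1≉0
  singular⇒null {ℕ.suc m} N det≈0 with any? (λ j → ¬? (cofactor N j ≟ 0#))
  ... | yes (j , c≉0) = cofactor N , (λ i → *-cofactor N i det≈0) , j , c≉0
  ... | no  none      = combine (missing zero)
    where
    minor≈0 : ∀ j → det (minor N zero j) ≈ 0#
    minor≈0 j = begin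
      d                  ≈⟨ *-identityˡ d ⟨
      1# * d             ≈⟨ *-congʳ (sgn*sgn j) ⟨
      sgn j * sgn j * d  ≈⟨ *-assoc _ _ _ ⟩
      sgn j * cofactor N j ≈⟨ *-congˡ (decidable-stable (cofactor N j ≟ 0#) λ c≉0 → none (j , c≉0)) ⟩
      sgn j * 0#         ≈⟨ zeroʳ _ ⟩
      0#                 ∎
      where d = det (minor N zero j)
    Missing : Fin (ℕ.suc m) → Set
    Missing j = ∃ λ x → x j ≈ 0# × NullVector (N ∘ suc) x
    missing : ∀ j → Missing j
    missing j with singular⇒null (minor N zero j) (minor≈0 j)
    ... | x , Nx≈0 , k , xₖ≉0 =
      x⁺ , reflexive x⁺ⱼ , rows , punchIn j k , λ x⁺≈0 → xₖ≉0 (trans (sym (reflexive (x⁺ₖ k))) x⁺≈0)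
      where
      x⁺ : Vector (ℕ.suc m)
      x⁺ = insertAt x j 0#
      x⁺ⱼ = insertAt-lookup x j 0#
      x⁺ₖ = insertAt-punchIn x j 0#
      rows : ∀ i → sum (λ c → N (suc i) c * x⁺ c) ≈ 0#
      rows i = begin
        sum (λ c → N (suc i) c * x⁺ c)
          ≈⟨ sum-remove {i = j} (λ c → N (suc i) c * x⁺ c) ⟩
        N (suc i) j * x⁺ j + sum (λ c → N (suc i) (punchIn j c) * x⁺ (punchIn j c))
          ≈⟨ +-cong (*-congˡ (reflexive x⁺ⱼ)) (sum-cong-≋ {m} λ c → *-congˡ (reflexive (x⁺ₖ c))) ⟩
        N (suc i) j * 0# + sum (λ c → N (suc i) (punchIn j c) * x c)
          ≈⟨ +-cong (zeroʳ _) (Nx≈0 i) ⟩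
        0# + 0#  ≈⟨ +-identityˡ _ ⟩
        0#       ∎
    combine : Missing zero → ∃ (NullVector N)
    -- `y` is chosen to vanish at an index `j` where `x` does not. This makes the two independent
    -- and leaves `z j` equal to `b * x j`.
    combine (x , _ , Nx≈0 , j , xⱼ≉0) with missing j
    ... | y , yⱼ≈0 , Ny≈0 , k , yₖ≉0 with sum (λ c → N zero c * y c) ≟ 0#
    ...   | yes N₀y≈0 = y , (λ { zero → N₀y≈0 ; (suc i) → Ny≈0 i }) , k , yₖ≉0
    ...   | no  b≉0   = z , rows , j , zⱼ≉0
      where
      a = sum λ c → N zero c * x c
      b = sum λ c → N zero c * y c
      z : Vector (ℕ.suc m)
      z c = b * x c + (- 1# * a) * y c
      rows : ∀ i → sum (λ c → N i c * z c) ≈ 0#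
      rows zero = begin
        sum (λ c → N zero c * z c)   ≈⟨ sum-linear (N zero) x y b (- 1# * a) ⟩
        b * a + (- 1# * a) * b       ≈⟨ solve 3 (λ m a b → b :* a :+ (m :* a) :* b := b :* a :+ m :* (b :* a)) refl
                                          (- 1#) a b ⟩
        b * a + - 1# * (b * a)       ≈⟨ x+-1*x≈0 _ ⟩
        0# ∎
      rows (suc i) = begin
        sum (λ c → N (suc i) c * z c)  ≈⟨ sum-linear (N (suc i)) x y b (- 1# * a) ⟩
        b * _ + (- 1# * a) * _         ≈⟨ +-cong (*-congˡ (Nx≈0 i)) (*-congˡ (Ny≈0 i)) ⟩
        b * 0# + (- 1# * a) * 0#       ≈⟨ +-cong (zeroʳ _) (zeroʳ _) ⟩
        0# + 0#                        ≈⟨ +-identityˡ _ ⟩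
        0# ∎
      zⱼ≉0 : ¬ z j ≈ 0#
      zⱼ≉0 zⱼ≈0 = xⱼ≉0 (cancel-≉0 b≉0 (begin
        b * x j                        ≈⟨ +-identityʳ _ ⟨
        b * x j + 0#                   ≈⟨ +-congˡ (trans (*-congˡ yⱼ≈0) (zeroʳ _)) ⟨
        z j                            ≈⟨ zⱼ≈0 ⟩
        0# ∎))

  -- Removing row 0 and a column of the same colour keeps the counts different.
  det-unbalanced : ∀ {m} (N : Matrix m) (p q : Fin m → Bool) →
                   (∀ i j → p i ≢ q j → N i j ≈ 0#) → count p ≢ count q → det N ≈ 0#
  det-unbalanced {ℕ.zero}  N p q off p≢q = contradiction ≡.refl p≢q
  det-unbalanced {ℕ.suc m} N p q off p≢q = sum-zero {ℕ.suc m} term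
    where
    term : ∀ j → sgn j * N zero j * det (minor N zero j) ≈ 0#
    term j with p zero Bool.≟ q j
    ... | no  p₀≢qⱼ = zero-middle (off zero j p₀≢qⱼ)
    ... | yes p₀≡qⱼ = trans (*-congˡ (det-unbalanced (minor N zero j) (p ∘ suc) (q ∘ punchIn j)
            (λ r c → off (suc r) (punchIn j c))
            λ eq → p≢q (≡.trans (≡.cong₂ (λ b k → (if b then 1 else 0) ℕ.+ k) p₀≡qⱼ eq)
                                (≡.sym (count-punchIn q j))))) (zeroʳ _)

-- Enumeration of a subset with one element deleted.

skip : ∀ {n} → Fin n → Fin (pred n) → Fin n
skip {ℕ.suc n} = punchIn

elements-∈ : ∀ {n} (S : Subset n) i → elements S i ∈ S
elements-∈ (true  ∷ S) zero    = here
elements-∈ (true  ∷ S) (suc i) = there (elements-∈ S i)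
elements-∈ (false ∷ S) i       = there (elements-∈ S i)

elements-injective : ∀ {n} (S : Subset n) {i j} → elements S i ≡ elements S j → i ≡ j
elements-injective (true  ∷ S) {zero}  {zero}  eq = ≡.refl
elements-injective (true  ∷ S) {suc i} {suc j} eq = ≡.cong suc (elements-injective S (suc-injective eq))
elements-injective (false ∷ S)                 eq = elements-injective S (suc-injective eq)

elements-surjective : ∀ {n} (S : Subset n) {v} → v ∈ S → ∃ λ i → elements S i ≡ v
elements-surjective (true  ∷ S) here        = zero , ≡.refl
elements-surjective (true  ∷ S) (there v∈S) with elements-surjective S v∈S
... | i , eq = suc i , ≡.cong suc eq
elements-surjective (false ∷ S) (there v∈S) with elements-surjective S v∈S
... | i , eq = i , ≡.cong suc eq

-- The equation of sizes is part of the data because `∣ S ∖ v ∣` is `pred ∣ S ∣` only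
-- propositionally; `pred` and `skip` apply although `∣ S ∣` is not visibly a successor.
Removes : ∀ {k l} {A : Set} → (Fin l → A) → (Fin k → A) → Fin k → Set
Removes {k} {l} g f j = ∃ λ (eq : l ≡ pred k) → ∀ i → g i ≡ f (skip j (cast eq i))

removes-suc : ∀ {k l n} {f : Fin (ℕ.suc k) → Fin (ℕ.suc n)} {g : Fin (ℕ.suc l) → Fin (ℕ.suc n)}
              {f′ : Fin k → Fin n} {g′ : Fin l → Fin n} →
              g zero ≡ f zero → (∀ i → f (suc i) ≡ suc (f′ i)) → (∀ i → g (suc i) ≡ suc (g′ i)) →
              ∀ j → Removes g′ f′ j → Removes g f (suc j)
removes-suc {ℕ.suc k} g₀≡f₀ f≡f′ g≡g′ j (eq , removed) = ≡.cong ℕ.suc eq , λ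
  { zero    → g₀≡f₀
  ; (suc i) → ≡.trans (g≡g′ i) (≡.trans (≡.cong suc (removed i)) (≡.sym (f≡f′ _))) }

elements-∖ : ∀ {n} (S : Subset n) (j : Fin ∣ S ∣) →
             Removes (elements (S ∖ elements S j)) (elements S) j
elements-∖ (true ∷ S) zero =
  -- The tail of `(true ∷ S) ∖ zero` is `S ─ ⊥`, which equals `S` only propositionally.
  ≡.subst (λ T → ∃ λ (eq : ∣ T ∣ ≡ ∣ S ∣) → ∀ i → suc (elements T i) ≡ suc (elements S (cast eq i)))
    (≡.sym (p─⊥≡p S)) (≡.refl , λ i → ≡.cong (suc ∘ elements S) (≡.sym (cast-is-id ≡.refl i)))
elements-∖ (true ∷ S) (suc j) =
  removes-suc {f = elements (true ∷ S)} {f′ = elements S}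
    ≡.refl (λ _ → ≡.refl) (λ _ → ≡.refl) j (elements-∖ S j)
elements-∖ (false ∷ S) j with elements-∖ S j
... | eq , removed = eq , λ i → ≡.cong suc (removed i)

-- Matching sums and determinants of forests.

module Matching (R : RealNumbers) where

  open RealNumbers R hiding (zero)
  open Spectral R
  open Determinant R
  open Algebra.Properties.Ring ring using (+-cancelˡ)
  open Algebra.Properties.Semiring.Sum semiring
    using (sum; sum-cong-≋; sum-remove; ∑-comm; ∑-distrib-+; *-distribˡ-sum)
  open Algebra.Solver.Ring.NaturalCoefficients.Default commutativeSemiring
    using (solve; _:+_; _:*_; _:=_; con)
  open Relation.Binary.Reasoning.Setoid setoid

  sumOver : ∀ {n} → Subset n → Vector n → ℝ
  sumOver S f = sum (f ∘ elements S)

  sumOver-cong : ∀ {n} (S : Subset n) {f g : Vector n} → (∀ {v} → v ∈ S → f v ≈ g v) →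
                 sumOver S f ≈ sumOver S g
  sumOver-cong S f≈g = sum-cong-≋ {∣ S ∣} λ i → f≈g (elements-∈ S i)

  sumOver-+ : ∀ {n} (S : Subset n) (f g : Vector n) →
              sumOver S (λ v → f v + g v) ≈ sumOver S f + sumOver S g
  sumOver-+ S f g = ∑-distrib-+ (f ∘ elements S) (g ∘ elements S)

  sumOver-* : ∀ {n} (S : Subset n) c (f : Vector n) → sumOver S (λ v → c * f v) ≈ c * sumOver S f
  sumOver-* S c f = sym (*-distribˡ-sum c (f ∘ elements S))

  sumOver-full : ∀ {n} (S : Subset n) (f : Vector n) → (∀ v → v ∉ S → f v ≈ 0#) → sum f ≈ sumOver S f
  sumOver-full []          f f≈0 = refl
  sumOver-full (true  ∷ S) f f≈0 = +-congˡ (sumOver-full S (f ∘ suc) λ v v∉S → f≈0 (suc v) (v∉S ∘ drop-there))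
  sumOver-full (false ∷ S) f f≈0 = begin
    f zero + sum (f ∘ suc)  ≈⟨ +-cong (f≈0 zero λ ()) (
                                 sumOver-full S (f ∘ suc) λ v v∉S → f≈0 (suc v) (v∉S ∘ drop-there)) ⟩
    0# + sumOver S (f ∘ suc) ≈⟨ +-identityˡ _ ⟩
    sumOver S (f ∘ suc)     ∎

  sumOver-remove : ∀ {n} (S : Subset n) (f : Vector n) {w} → w ∈ S → sumOver S f ≈ f w + sumOver (S ∖ w) f
  sumOver-remove (true ∷ S) f here =
    +-congˡ (reflexive (≡.cong (λ T → sumOver T (f ∘ suc)) (≡.sym (p─⊥≡p S))))
  sumOver-remove (true ∷ S) f {suc w} (there w∈S) = begin
    f zero + sumOver S (f ∘ suc)
      ≈⟨ +-congˡ (sumOver-remove S (f ∘ suc) w∈S) ⟩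
    f zero + (f (suc w) + sumOver (S ∖ w) (f ∘ suc))
      ≈⟨ solve 3 (λ x y z → x :+ (y :+ z) := y :+ (x :+ z)) refl (f zero) (f (suc w)) (sumOver (S ∖ w) (f ∘ suc)) ⟩
    f (suc w) + (f zero + sumOver (S ∖ w) (f ∘ suc)) ∎
  sumOver-remove (false ∷ S) f (there w∈S) = sumOver-remove S (f ∘ suc) w∈S

  -- Adding the diagonal terms completes both sides to sums over all pairs, whose order can be
  -- exchanged; the diagonal is then cancelled.
  sumOver-swap : ∀ {n} (S : Subset n) (f : Matrix n) →
                 sumOver S (λ v → sumOver (S ∖ v) (λ w → f v w)) ≈
                 sumOver S (λ v → sumOver (S ∖ v) (λ w → f w v))
  sumOver-swap S f = +-cancelˡ (sumOver S (λ v → f v v)) _ _ (begin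
    sumOver S (λ v → f v v) + sumOver S (λ v → sumOver (S ∖ v) (f v))
      ≈⟨ sumOver-+ S (λ v → f v v) (λ v → sumOver (S ∖ v) (f v)) ⟨
    sumOver S (λ v → f v v + sumOver (S ∖ v) (f v))
      ≈⟨ sumOver-cong S (λ {v} v∈S → sumOver-remove S (f v) v∈S) ⟨
    sumOver S (λ v → sumOver S (f v))
      ≈⟨ ∑-comm (λ i j → f (elements S i) (elements S j)) ⟩
    sumOver S (λ v → sumOver S (λ w → f w v))
      ≈⟨ sumOver-cong S (λ {v} v∈S → sumOver-remove S (λ w → f w v) v∈S) ⟩
    sumOver S (λ v → f v v + sumOver (S ∖ v) (λ w → f w v))
      ≈⟨ sumOver-+ S (λ v → f v v) (λ v → sumOver (S ∖ v) (λ w → f w v)) ⟩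
    sumOver S (λ v → f v v) + sumOver S (λ v → sumOver (S ∖ v) (λ w → f w v)) ∎)

  -- The sum over the matchings of S, where a matching contributes - Mᵥᵥ′ Mᵥ′ᵥ
  -- for each of its edges and Mᵥᵥ for each unmatched vertex.
  matchingSum : ∀ {n} → Matrix n → Subset n → ℝ
  edgeTerms : ∀ {n} → Matrix n → Fin n → Subset n → ℝ

  matchingSum M []          = 1#
  matchingSum M (true  ∷ S) =
    M zero zero * matchingSum (tail² M) S +
    - 1# * sumOver S λ v → M zero (suc v) * M (suc v) zero * matchingSum (tail² M) (S ∖ v)
  matchingSum M (false ∷ S) = matchingSum (tail² M) S

  edgeTerms M w S = sumOver S λ v → M w v * M v w * matchingSum M (S ∖ v)

  -- True for every matrix: a matching leaves `w` single or pairs it with some `v`. As `matchingSum`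
  -- is built from the least vertex, a later `w` requires expanding at both vertices and comparing
  -- the two orders.
  matchingSum-expand : ∀ {n} (M : Matrix n) (S : Subset n) {w} → w ∈ S →
    matchingSum M S ≈ M w w * matchingSum M (S ∖ w) + - 1# * edgeTerms M w (S ∖ w)
  matchingSum-expand M (true  ∷ S) here = reflexive
    (≡.cong (λ T → M zero zero * matchingSum (tail² M) T + - 1# * edgeTerms M zero (false ∷ T))
            (≡.sym (p─⊥≡p S)))
  matchingSum-expand M (false ∷ S) (there w∈S) = matchingSum-expand (tail² M) S w∈S
  matchingSum-expand M (true  ∷ S) {suc w} (there w∈S) = begin
    M₀₀ * μ S + - 1# * sumOver S (λ v → m₀ v * μ (S ∖ v))
      ≈⟨ +-cong (*-congˡ (matchingSum-expand (tail² M) S w∈S))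
                (*-congˡ (sumOver-remove S (λ v → m₀ v * μ (S ∖ v)) w∈S)) ⟩
    M₀₀ * (Mww * μ T + - 1# * X) + - 1# * (m₀ w * μ T + sumOver T (λ v → m₀ v * μ (S ∖ v)))
      ≈⟨ +-congˡ (*-congˡ (+-congˡ (trans inner (+-congˡ (*-congˡ (sym swapped)))))) ⟩
    M₀₀ * (Mww * μ T + - 1# * X) + - 1# * (m₀ w * μ T + (Mww * Y + - 1# * Z))
      ≈⟨ solve 8 (λ a b c d x y z m →
           a :* (b :* d :+ m :* x) :+ m :* (c :* d :+ (b :* y :+ m :* z)) :=
           b :* (a :* d :+ m :* y) :+ m :* (c :* d :+ (a :* x :+ m :* z))) refl
           M₀₀ Mww (m₀ w) (μ T) X Y Z (- 1#) ⟩
    Mww * (M₀₀ * μ T + - 1# * Y) + - 1# * (m₀ w * μ T + (M₀₀ * X + - 1# * Z))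
      ≈⟨ +-congˡ (*-congˡ (+-cong first rest)) ⟩
    Mww * matchingSum M (true ∷ T) + - 1# * edgeTerms M (suc w) (true ∷ T) ∎
    where
    T = S ∖ w
    μ = matchingSum (tail² M)
    M₀₀ = M zero zero
    Mww = M (suc w) (suc w)
    m₀ : Vector _
    m₀ v = M zero (suc v) * M (suc v) zero
    mw : Vector _
    mw v = M (suc w) (suc v) * M (suc v) (suc w)
    -- In `X` only `w` is paired, in `Y` only vertex 0, in `Z` both are, with different partners;
    -- `m₀ w * μ T` is the case where they are paired with each other.
    X = sumOver T λ v → mw v * μ (T ∖ v)
    Y = sumOver T λ v → m₀ v * μ (T ∖ v)
    Z = sumOver T λ v → sumOver (T ∖ v) λ x → mw v * (m₀ x * μ (T ∖ v ∖ x))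
    Z′ = sumOver T λ v → m₀ v * sumOver (T ∖ v) λ x → mw x * μ (T ∖ v ∖ x)
    swapped : Z ≈ Z′
    swapped = begin
      Z ≈⟨ sumOver-swap T (λ v x → mw v * (m₀ x * μ (T ∖ v ∖ x))) ⟩
      sumOver T (λ v → sumOver (T ∖ v) λ x → mw x * (m₀ v * μ (T ∖ x ∖ v)))
        ≈⟨ sumOver-cong T (λ {v} _ → begin
             sumOver (T ∖ v) (λ x → mw x * (m₀ v * μ (T ∖ x ∖ v)))
               ≈⟨ sumOver-cong (T ∖ v) (λ {x} _ → begin
                    mw x * (m₀ v * μ (T ∖ x ∖ v))
                      ≡⟨ ≡.cong (λ Q → mw x * (m₀ v * μ Q)) (p─x─y≡p─y─x T x v) ⟩
                    mw x * (m₀ v * μ (T ∖ v ∖ x))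
                      ≈⟨ solve 3 (λ a b c → a :* (b :* c) := b :* (a :* c)) refl (mw x) (m₀ v) (μ (T ∖ v ∖ x)) ⟩
                    m₀ v * (mw x * μ (T ∖ v ∖ x)) ∎) ⟩
             sumOver (T ∖ v) (λ x → m₀ v * (mw x * μ (T ∖ v ∖ x)))
               ≈⟨ sumOver-* (T ∖ v) (m₀ v) (λ x → mw x * μ (T ∖ v ∖ x)) ⟩
             m₀ v * sumOver (T ∖ v) (λ x → mw x * μ (T ∖ v ∖ x)) ∎) ⟩
      Z′ ∎
    inner : sumOver T (λ v → m₀ v * μ (S ∖ v)) ≈ Mww * Y + - 1# * Z′
    inner = begin
      sumOver T (λ v → m₀ v * μ (S ∖ v))
        ≈⟨ sumOver-cong T (λ {v} v∈T → begin
             m₀ v * μ (S ∖ v)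
               ≈⟨ *-congˡ (matchingSum-expand (tail² M) (S ∖ v) (w∈S∖ v∈T)) ⟩
             m₀ v * (Mww * μ (S ∖ v ∖ w) + - 1# * edgeTerms (tail² M) w (S ∖ v ∖ w))
               ≡⟨ ≡.cong (λ Q → m₀ v * (Mww * μ Q + - 1# * edgeTerms (tail² M) w Q)) (p─x─y≡p─y─x S v w) ⟩
             m₀ v * (Mww * μ (T ∖ v) + - 1# * edgeTerms (tail² M) w (T ∖ v))
               ≈⟨ solve 5 (λ a b c m d → a :* (b :* c :+ m :* d) := b :* (a :* c) :+ m :* (a :* d)) refl
                    (m₀ v) Mww (μ (T ∖ v)) (- 1#) (edgeTerms (tail² M) w (T ∖ v)) ⟩
             Mww * (m₀ v * μ (T ∖ v)) + - 1# * (m₀ v * edgeTerms (tail² M) w (T ∖ v)) ∎) ⟩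
      sumOver T (λ v → Mww * (m₀ v * μ (T ∖ v)) + - 1# * (m₀ v * edgeTerms (tail² M) w (T ∖ v)))
        ≈⟨ sumOver-+ T (λ v → Mww * (m₀ v * μ (T ∖ v))) (λ v → - 1# * (m₀ v * edgeTerms (tail² M) w (T ∖ v))) ⟩
      sumOver T (λ v → Mww * (m₀ v * μ (T ∖ v))) +
      sumOver T (λ v → - 1# * (m₀ v * edgeTerms (tail² M) w (T ∖ v)))
        ≈⟨ +-cong (sumOver-* T Mww (λ v → m₀ v * μ (T ∖ v)))
                  (sumOver-* T (- 1#) (λ v → m₀ v * edgeTerms (tail² M) w (T ∖ v))) ⟩
      Mww * Y + - 1# * Z′ ∎
      where
      w∈S∖ : ∀ {v} → v ∈ T → w ∈ S ∖ v
      w∈S∖ v∈T = x∈p∧x≢y⇒x∈p-y w∈S λ { ≡.refl → ∉-∖ S v∈T }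
        where
        ∉-∖ : ∀ {n} (S : Subset n) {v} → v ∉ S ∖ v
        ∉-∖ (_ ∷ S) {zero}  ()
        ∉-∖ (_ ∷ S) {suc v} (there v∈) = ∉-∖ S v∈
    first : m₀ w * μ T ≈ M (suc w) zero * M zero (suc w) * matchingSum M ((true ∷ T) ∖ zero)
    first = *-cong (*-comm _ _) (reflexive (≡.cong μ (≡.sym (p─⊥≡p T))))
    rest : M₀₀ * X + - 1# * Z ≈ sumOver T (λ v → mw v * matchingSum M (true ∷ (T ∖ v)))
    rest = begin
      M₀₀ * X + - 1# * Z
        ≈⟨ +-cong (sumOver-* T M₀₀ (λ v → mw v * μ (T ∖ v)))
                  (sumOver-* T (- 1#) (λ v → sumOver (T ∖ v) λ x → mw v * (m₀ x * μ (T ∖ v ∖ x)))) ⟨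
      sumOver T (λ v → M₀₀ * (mw v * μ (T ∖ v))) +
      sumOver T (λ v → - 1# * sumOver (T ∖ v) (λ x → mw v * (m₀ x * μ (T ∖ v ∖ x))))
        ≈⟨ sumOver-+ T (λ v → M₀₀ * (mw v * μ (T ∖ v)))
             (λ v → - 1# * sumOver (T ∖ v) (λ x → mw v * (m₀ x * μ (T ∖ v ∖ x)))) ⟨
      sumOver T (λ v → M₀₀ * (mw v * μ (T ∖ v)) + - 1# * sumOver (T ∖ v) (λ x → mw v * (m₀ x * μ (T ∖ v ∖ x))))
        ≈⟨ sumOver-cong T (λ {v} _ → begin
             M₀₀ * (mw v * μ (T ∖ v)) + - 1# * sumOver (T ∖ v) (λ x → mw v * (m₀ x * μ (T ∖ v ∖ x)))
               ≈⟨ +-congˡ (*-congˡ (sumOver-* (T ∖ v) (mw v) (λ x → m₀ x * μ (T ∖ v ∖ x)))) ⟩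
             M₀₀ * (mw v * μ (T ∖ v)) + - 1# * (mw v * sumOver (T ∖ v) (λ x → m₀ x * μ (T ∖ v ∖ x)))
               ≈⟨ solve 5 (λ a b c m d → a :* (b :* c) :+ m :* (b :* d) := b :* (a :* c :+ m :* d)) refl
                    M₀₀ (mw v) (μ (T ∖ v)) (- 1#) (sumOver (T ∖ v) (λ x → m₀ x * μ (T ∖ v ∖ x))) ⟩
             mw v * (M₀₀ * μ (T ∖ v) + - 1# * sumOver (T ∖ v) (λ x → m₀ x * μ (T ∖ v ∖ x))) ∎) ⟩
      sumOver T (λ v → mw v * matchingSum M (true ∷ (T ∖ v))) ∎

  sum-single : ∀ {n} (f : Vector n) j → (∀ i → i ≢ j → f i ≈ 0#) → sum f ≈ f j
  sum-single {ℕ.suc n} f j f≈0 = begin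
    sum f                          ≈⟨ sum-remove {i = j} f ⟩
    f j + sum (f ∘ punchIn j)      ≈⟨ +-congˡ (sum-zero {n} λ i → f≈0 (punchIn j i) (punchInᵢ≢i j i)) ⟩
    f j + 0#                       ≈⟨ +-identityʳ _ ⟩
    f j                            ∎

  -- No cycles in the graph of M: removing a vertex z puts any two of its
  -- neighbours j and r into different components, which the colouring c tells
  -- apart.
  Separated : ∀ {n} → Matrix n → Set
  Separated {n} M = ∀ z j r → j ≢ z → r ≢ z → j ≢ r → ¬ M z j ≈ 0# → ¬ M r z ≈ 0# →
    ∃ λ (c : Fin n → Bool) → c j ≡ true × c r ≡ false ×
      (∀ x y → x ≢ z → y ≢ z → c x ≢ c y → M x y ≈ 0#)

  Separated-tail : ∀ {n} {M : Matrix (ℕ.suc n)} → Separated M → Separated (tail² M)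
  Separated-tail sep z j r j≢z r≢z j≢r Mzj Mrz
    with sep (suc z) (suc j) (suc r) (j≢z ∘ suc-injective) (r≢z ∘ suc-injective) (j≢r ∘ suc-injective) Mzj Mrz
  ... | c , cj , cr , off = (λ x → c (suc x)) , cj , cr , λ x y x≢z y≢z →
    off (suc x) (suc y) (x≢z ∘ suc-injective) (y≢z ∘ suc-injective)

  -- The cross terms with j ≢ r contain the minors of a block matrix with
  -- non-square blocks.
  det-separated : ∀ {m} (N : Matrix (ℕ.suc m)) →
    (∀ j r → j ≢ r → ¬ N zero (suc j) ≈ 0# → ¬ N (suc r) zero ≈ 0# →
       ∃ λ (c : Fin m → Bool) → c j ≡ true × c r ≡ false × (∀ x y → c x ≢ c y → tail² N x y ≈ 0#)) →
    det N ≈ N zero zero * det (tail² N) + - 1# *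
      sum λ j → N zero (suc j) * N (suc j) zero * det (λ x y → tail² N (skip j x) (skip j y))
  det-separated {ℕ.zero} N sep =
    solve 2 (λ a m → con 1 :* a :* con 1 :+ con 0 := a :* con 1 :+ m :* con 0) refl (N zero zero) (- 1#)
  det-separated {ℕ.suc m} N sep = trans (det-cross N) (+-congˡ (sum-scale (- 1#)
    {g = λ j → N zero (suc j) * N (suc j) zero * det (minor (tail² N) j j)} λ j → begin
    sum (crossTerm N j)
      ≈⟨ sum-single (crossTerm N j) j (λ r r≢j → trans (*-congˡ (vanish j r (r≢j ∘ ≡.sym))) (zeroʳ _)) ⟩
    crossTerm N j j
      ≈⟨ *-congʳ (trans (*-congˡ (sgn*sgn j)) (*-identityʳ _)) ⟩
    - 1# * (N zero (suc j) * N (suc j) zero * det (minor (tail² N) j j)) ∎))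
    where
    vanish : ∀ j r → j ≢ r → N zero (suc j) * N (suc r) zero * det (minor (tail² N) r j) ≈ 0#
    vanish j r j≢r with N zero (suc j) ≟ 0# | N (suc r) zero ≟ 0#
    ... | yes a≈0 | _       = trans (*-congʳ (trans (*-congʳ a≈0) (zeroˡ _))) (zeroˡ _)
    ... | no  _   | yes b≈0 = zero-middle b≈0
    ... | no  a≉0 | no  b≉0 with sep j r j≢r a≉0 b≉0
    -- Column `j` has colour true and row `r` colour false, so the minor has one more true row than
    -- true columns.
    ...   | c , cj , cr , off = trans (*-congˡ (det-unbalanced (minor (tail² N) r j)
              (c ∘ punchIn r) (c ∘ punchIn j) (λ x y → off (punchIn r x) (punchIn j y))
              λ eq → ℕ.1+n≢n (≡.trans (≡.sym countʲ) (≡.trans countʳ eq)))) (zeroʳ _)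
      where
      countʲ : count c ≡ ℕ.suc (count (c ∘ punchIn j))
      countʲ = ≡.trans (count-punchIn c j) (≡.cong (λ b → (if b then 1 else 0) ℕ.+ count (c ∘ punchIn j)) cj)
      countʳ : count c ≡ count (c ∘ punchIn r)
      countʳ = ≡.trans (count-punchIn c r) (≡.cong (λ b → (if b then 1 else 0) ℕ.+ count (c ∘ punchIn r)) cr)

  det-removes : ∀ {k l n} (M : Matrix n) (f : Fin k → Fin n) (g : Fin l → Fin n) {j} → Removes g f j →
    det (λ x y → M (f (skip j x)) (f (skip j y))) ≈ det (λ x y → M (g x) (g y))
  det-removes {k} M f g {j} (≡.refl , removed) =
    det-cong (λ x y → M (f (skip j x)) (f (skip j y))) (λ x y → M (g x) (g y)) λ x y →
      reflexive (≡.cong₂ M (g≡f x) (g≡f y))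
    where
    g≡f : ∀ x → f (skip j x) ≡ g x
    g≡f x = ≡.trans (≡.cong (f ∘ skip j) (≡.sym (cast-is-id ≡.refl x))) (≡.sym (removed x))

  -- `det-separated` has the same recursive shape as `matchingSum`. Colourings restrict to subsets
  -- of the vertices, so one hypothesis on `M` serves all its principal submatrices.
  det≈matchingSum : ∀ {n} (M : Matrix n) → Separated M → ∀ S → det (M [ S ]) ≈ matchingSum M S
  det≈matchingSum M sep []          = refl
  det≈matchingSum M sep (false ∷ S) = det≈matchingSum (tail² M) (Separated-tail sep) S
  det≈matchingSum M sep (true  ∷ S) = begin
    det (M [ true ∷ S ])
      ≈⟨ det-separated (M [ true ∷ S ]) separated ⟩
    M zero zero * det (tail² M [ S ]) + - 1# *
      sum (λ j → m₀ (elements S j) * det (λ x y → tail² M (elements S (skip j x)) (elements S (skip j y))))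
      ≈⟨ +-cong (*-congˡ (det≈matchingSum (tail² M) (Separated-tail sep) S))
           (*-congˡ (sum-cong-≋ {∣ S ∣} λ j → *-congˡ {m₀ (elements S j)} (trans
              (det-removes (tail² M) (elements S) (elements (S ∖ elements S j)) (elements-∖ S j))
              (det≈matchingSum (tail² M) (Separated-tail sep) (S ∖ elements S j))))) ⟩
    matchingSum M (true ∷ S) ∎
    where
    m₀ : Vector _
    m₀ v = M zero (suc v) * M (suc v) zero
    separated : ∀ j r → j ≢ r → ¬ M zero (suc (elements S j)) ≈ 0# → ¬ M (suc (elements S r)) zero ≈ 0# →
       ∃ λ (c : Fin ∣ S ∣ → Bool) → c j ≡ true × c r ≡ false × (∀ x y → c x ≢ c y → (tail² M [ S ]) x y ≈ 0#)
    separated j r j≢r M₀ⱼ Mᵣ₀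
      with sep zero (suc (elements S j)) (suc (elements S r)) (λ ()) (λ ())
             (j≢r ∘ elements-injective S ∘ suc-injective) M₀ⱼ Mᵣ₀
    ... | c , cj , cr , off = (λ x → c (suc (elements S x))) , cj , cr , λ x y →
      off (suc (elements S x)) (suc (elements S y)) (λ ()) (λ ())

-- Paths in forests.

x∉p∖x : ∀ {n} (p : Subset n) {x} → x ∉ p ∖ x
x∉p∖x (_ ∷ p) {zero}  ()
x∉p∖x (_ ∷ p) {suc x} (there x∈) = x∉p∖x p x∈

x∈p∖y⇒x∈p : ∀ {n} {p : Subset n} {x y} → x ∈ p ∖ y → x ∈ p
x∈p∖y⇒x∈p {p = p} {y = y} = p─q⊆p p ⁅ y ⁆

x∈p∖y⇒x≢y : ∀ {n} {p : Subset n} {x y} → x ∈ p ∖ y → x ≢ y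
x∈p∖y⇒x≢y {p = p} x∈p∖x ≡.refl = x∉p∖x p x∈p∖x

∖-monoˡ : ∀ {n} {p q : Subset n} {x} → p ⊆ q → p ∖ x ⊆ q ∖ x
∖-monoˡ p⊆q y∈p∖x = x∈p∧x≢y⇒x∈p-y (p⊆q (x∈p∖y⇒x∈p y∈p∖x)) (x∈p∖y⇒x≢y y∈p∖x)

module ForestPaths {n : ℕ} (E : Rel (Fin n) 0ℓ) (E-sym : ∀ {u v} → E u v → E v u) where

  open Paths E

  source∈ : ∀ {S u v} → Path S u v → u ∈ S
  source∈ (stop u∈S _)     = u∈S
  source∈ (step _ u∈S _ _) = u∈S

  target∈ : ∀ {S u v} → Path S u v → v ∈ S
  target∈ (stop u∈S ≡.refl) = u∈S
  target∈ (step _ _ _ p)    = x∈p∖y⇒x∈p (target∈ p)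

  weaken : ∀ {S T u v} → S ⊆ T → Path S u v → Path T u v
  weaken S⊆T (stop u∈S u≡v)   = stop (S⊆T u∈S) u≡v
  weaken S⊆T (step w u∈S e p) = step w (S⊆T u∈S) e (weaken (∖-monoˡ S⊆T) p)

  -- If the path already visits `w`, it is cut off there, so that no vertex is repeated.
  path-snoc : ∀ {S u v w} → Path S u v → E v w → w ∈ S → Path S u w
  path-snoc {u = u} {w = w} p e w∈S with u ≟ᶠ w
  path-snoc p                    e w∈S | yes u≡w = stop (source∈ p) u≡w
  path-snoc (stop u∈S ≡.refl)    e w∈S | no  u≢w = step _ u∈S e (stop (x∈p∧x≢y⇒x∈p-y w∈S (u≢w ∘ ≡.sym)) ≡.refl)
  path-snoc (step x u∈S e′ p)    e w∈S | no  u≢w = step x u∈S e′ (path-snoc p e (x∈p∧x≢y⇒x∈p-y w∈S (u≢w ∘ ≡.sym)))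

  path-append : ∀ {S T u v w} → T ⊆ S → Path S u v → Path T v w → Path S u w
  path-append T⊆S p (stop _ ≡.refl)  = p
  path-append T⊆S p (step x _ e q) =
    path-append (T⊆S ∘ x∈p∖y⇒x∈p) (path-snoc p e (T⊆S (x∈p∖y⇒x∈p (source∈ q)))) q

  path-reverse : ∀ {S u v} → Path S u v → Path S v u
  path-reverse (stop u∈S ≡.refl)  = stop u∈S ≡.refl
  path-reverse (step x u∈S e p) = path-snoc (weaken x∈p∖y⇒x∈p (path-reverse p)) (E-sym e) u∈S

  module _ (acyclic : Acyclic) where

    -- Prepending `z` would give a path of length at least two whose ends are adjacent, that is, a
    -- cycle.
    no-path-between-neighbours : ∀ {S z a b} → a ≢ b → E z a → E z b → ¬ Path (S ∖ z) a b
    no-path-between-neighbours {S} {z} {a} {b} a≢b za zb p =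
      acyclic (step a ∈⊤ za q) (s≤s (nonempty q)) (E-sym zb)
      where
      q : Path (full ∖ z) a b
      q = weaken (∖-monoˡ λ _ → ∈⊤) p
      nonempty : ∀ {T} (q : Path T a b) → 1 ℕ.≤ length q
      nonempty (stop _ a≡b)   = contradiction a≡b a≢b
      nonempty (step _ _ _ _) = s≤s z≤n

    first-step-unique : ∀ {S u v a b} → E u a → E u b → Path (S ∖ u) a v → Path (S ∖ u) b v → a ≡ b
    first-step-unique {a = a} {b} ua ub p q with a ≟ᶠ b
    ... | yes a≡b = a≡b
    ... | no  a≢b = contradiction (path-append id p (path-reverse q)) (no-path-between-neighbours a≢b ua ub)

    -- Paths carry proofs of membership and adjacency, so they are compared only through what enters
    -- α: the vertex set here, the weight in `weight-unique`.
    vertices-unique : ∀ {S u v} (p q : Path S u v) → vertices p ≡ vertices q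
    vertices-unique (stop _ _)        (stop _ _)     = ≡.refl
    vertices-unique (stop _ ≡.refl)   (step _ _ _ q) = contradiction (target∈ q) (x∉p∖x _)
    vertices-unique (step _ _ _ p)    (stop _ ≡.refl) = contradiction (target∈ p) (x∉p∖x _)
    vertices-unique (step a _ ua p)   (step b _ ub q) with first-step-unique ua ub p q
    ... | ≡.refl = ≡.cong (⁅ _ ⁆ ∪_) (vertices-unique p q)

-- Eigenspaces and star sets.

module Eigenvectors (R : RealNumbers) where

  open RealNumbers R hiding (zero)
  open Spectral R
  open Determinant R
  open Matching R
  open Algebra.Properties.Semiring.Sum semiring
    using (sum; sum-cong-≋; ∑-comm; ∑-distrib-+; *-distribˡ-sum)
  open Algebra.Properties.Ring ring using (-1*x≈-x; +-cancelʳ)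
  open Algebra.Solver.Ring.NaturalCoefficients.Default commutativeSemiring
    using (solve; _:+_; _:*_; _:=_; con)
  open Relation.Binary.Reasoning.Setoid setoid hiding (stop)

  x+-1*y≈0⇒x≈y : ∀ {x y} → x + - 1# * y ≈ 0# → x ≈ y
  x+-1*y≈0⇒x≈y {x} {y} eq = begin
    x                       ≈⟨ +-identityʳ x ⟨
    x + 0#                  ≈⟨ +-congˡ (x+-1*x≈0 y) ⟨
    x + (y + - 1# * y)      ≈⟨ solve 3 (λ x y z → x :+ (y :+ z) := y :+ (x :+ z)) refl x y (- 1# * y) ⟩
    y + (x + - 1# * y)      ≈⟨ +-congˡ eq ⟩
    y + 0#                  ≈⟨ +-identityʳ y ⟩
    y                       ∎

  *-cancelˡ-≉0 : ∀ {c x y} → ¬ c ≈ 0# → c * x ≈ c * y → x ≈ y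
  *-cancelˡ-≉0 {c} {x} {y} c≉0 eq = x+-1*y≈0⇒x≈y (cancel-≉0 c≉0 (begin
    c * (x + - 1# * y)      ≈⟨ solve 4 (λ c x m y → c :* (x :+ m :* y) := c :* x :+ m :* (c :* y)) refl c x (- 1#) y ⟩
    c * x + - 1# * (c * y)  ≈⟨ +-congʳ eq ⟩
    c * y + - 1# * (c * y)  ≈⟨ x+-1*x≈0 _ ⟩
    0#                      ∎))

  identity-≡ : ∀ {n} (i : Fin n) → identity i i ≡ 1#
  identity-≡ i with i ≟ᶠ i
  ... | yes _   = ≡.refl
  ... | no  i≢i = contradiction ≡.refl i≢i

  identity-≢ : ∀ {n} {i j : Fin n} → i ≢ j → identity i j ≡ 0#
  identity-≢ {i = i} {j} i≢j with i ≟ᶠ j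
  ... | yes i≡j = contradiction i≡j i≢j
  ... | no  _   = ≡.refl

  identity-elements : ∀ {n} (S : Subset n) i j → identity i j ≡ identity (elements S i) (elements S j)
  identity-elements S i j with i ≟ᶠ j
  ... | yes ≡.refl = ≡.sym (identity-≡ (elements S i))
  ... | no  i≢j    = ≡.sym (identity-≢ (i≢j ∘ elements-injective S))

  characteristic : ∀ {n} → ℝ → Matrix n → Matrix n
  characteristic t B i j = t * identity i j - B i j

  characteristic-≢ : ∀ {n} t (B : Matrix n) {i j} → i ≢ j → characteristic t B i j ≈ - 1# * B i j
  characteristic-≢ t B {i} {j} i≢j = begin
    t * identity i j - B i j  ≈⟨ +-congʳ (trans (*-congˡ (reflexive (identity-≢ i≢j))) (zeroʳ t)) ⟩
    0# - B i j                ≈⟨ +-identityˡ _ ⟩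
    - B i j                   ≈⟨ -1*x≈-x _ ⟨
    - 1# * B i j              ∎

  characteristic-row : ∀ {n} t (B : Matrix n) x i →
    sum (λ j → characteristic t B i j * x j) ≈ t * x i + - 1# * sum (λ j → B i j * x j)
  characteristic-row {n} t B x i = begin
    sum (λ j → characteristic t B i j * x j)
      ≈⟨ sum-cong-≋ {n} (λ j → begin
           (t * identity i j - B i j) * x j         ≈⟨ *-congʳ (+-congˡ (sym (-1*x≈-x _))) ⟩
           (t * identity i j + - 1# * B i j) * x j
             ≈⟨ *-comm _ _ ⟩
           x j * (t * identity i j + - 1# * B i j)  ∎) ⟩
    sum (λ j → x j * (t * identity i j + - 1# * B i j))
      ≈⟨ sum-linear x (identity i) (B i) t (- 1#) ⟩
    t * sum (λ j → x j * identity i j) + - 1# * sum (λ j → x j * B i j)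
      ≈⟨ +-cong (*-congˡ diagonal) (*-congˡ (sum-cong-≋ {n} λ j → *-comm (x j) (B i j))) ⟩
    t * x i + - 1# * sum (λ j → B i j * x j) ∎
    where
    diagonal : sum (λ j → x j * identity i j) ≈ x i
    diagonal = begin
      sum (λ j → x j * identity i j)
        ≈⟨ sum-single (λ j → x j * identity i j) i (λ j j≢i →
             trans (*-congˡ (reflexive (identity-≢ (j≢i ∘ ≡.sym)))) (zeroʳ _)) ⟩
      x i * identity i i  ≈⟨ *-congˡ (reflexive (identity-≡ i)) ⟩
      x i * 1#            ≈⟨ *-identityʳ _ ⟩
      x i                 ∎

  null-row⇒eigen-row : ∀ {n} t (B : Matrix n) x i →
    sum (λ j → characteristic t B i j * x j) ≈ 0# → sum (λ j → B i j * x j) ≈ t * x i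
  null-row⇒eigen-row t B x i null =
    sym (x+-1*y≈0⇒x≈y (trans (sym (characteristic-row t B x i)) null))

  φ-principal : ∀ {n} t (B : Matrix n) S → φ (B [ S ]) t ≈ det (characteristic t B [ S ])
  φ-principal t B S = det-cong (characteristic t (B [ S ])) (characteristic t B [ S ]) λ i j →
    +-congʳ (*-congˡ (reflexive (identity-elements S i j)))

  extend : ∀ {n} (S : Subset n) → Vector ∣ S ∣ → Vector n
  extend S x v with v ∈? S
  ... | yes v∈S = x (proj₁ (elements-surjective S v∈S))
  ... | no  _   = 0#

  extend-∉ : ∀ {n} (S : Subset n) x {v} → v ∉ S → extend S x v ≈ 0#
  extend-∉ S x {v} v∉S with v ∈? S
  ... | yes v∈S = contradiction v∈S v∉S
  ... | no  _   = refl

  extend-elements : ∀ {n} (S : Subset n) x i → extend S x (elements S i) ≈ x i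
  extend-elements S x i with elements S i ∈? S
  ... | yes ∈S = reflexive (≡.cong x (elements-injective S (proj₂ (elements-surjective S ∈S))))
  ... | no  ∉S = contradiction (elements-∈ S i) ∉S

  eigen-combination : ∀ {n k t} {A : Matrix n} (c : Vector k) (b : Fin k → Vector n) →
    (∀ l → Eigenspace A t (b l)) → Eigenspace A t (combination c b)
  eigen-combination {n} {k} {t} {A} c b inside w = begin
    sum (λ v → A w v * sum (λ l → c l * b l v))
      ≈⟨ sum-cong-≋ {n} (λ v → *-distribˡ-sum (A w v) (λ l → c l * b l v)) ⟩
    sum (λ v → sum (λ l → A w v * (c l * b l v)))
      ≈⟨ ∑-comm (λ v l → A w v * (c l * b l v)) ⟩
    sum (λ l → sum (λ v → A w v * (c l * b l v)))
      ≈⟨ sum-scale t {g = λ l → c l * b l w} (λ l → begin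
           sum (λ v → A w v * (c l * b l v))
             ≈⟨ sum-scale (c l) {g = λ v → A w v * b l v} (λ v →
                  solve 3 (λ a c b → a :* (c :* b) := c :* (a :* b)) refl (A w v) (c l) (b l v)) ⟩
           c l * sum (λ v → A w v * b l v)
             ≈⟨ *-congˡ (inside l w) ⟩
           c l * (t * b l w)
             ≈⟨ solve 3 (λ c t b → c :* (t :* b) := t :* (c :* b)) refl (c l) t (b l w) ⟩
           t * (c l * b l w) ∎) ⟩
    t * combination c b w ∎

  -- Entries on `U` contribute nothing, so the restriction of `x` to the complement satisfies the
  -- eigenvalue equation of `A - U`; not being an eigenvector, it is zero.
  star-vanish : ∀ {n t} {A : Matrix n} {U : Subset n} → ¬ IsEigenvalue (delete A U) t →
    ∀ x → (∀ {v} → v ∈ U → x v ≈ 0#) → (∀ {w} → w ∉ U → sum (λ v → A w v * x v) ≈ t * x w) →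
    ∀ v → x v ≈ 0#
  star-vanish {n} {t} {A} {U} regular x x≈0 rows v = decidable-stable (x v ≟ 0#) λ xᵥ≉0 →
    regular (x ∘ elements (∁ U) , restricted , λ zero-on-∁U → xᵥ≉0 (on-∁U zero-on-∁U (x∉p⇒x∈∁p (xᵥ≉0 ∘ x≈0))))
    where
    on-∁U : (∀ i → x (elements (∁ U) i) ≈ 0#) → v ∈ ∁ U → x v ≈ 0#
    on-∁U vanishes v∈∁U with elements-surjective (∁ U) v∈∁U
    ... | i , ≡.refl = vanishes i
    restricted : Eigenspace (delete A U) t (x ∘ elements (∁ U))
    restricted i = begin
      sumOver (∁ U) (λ v → A w v * x v)
        ≈⟨ sumOver-full (∁ U) (λ v → A w v * x v) (λ v v∉∁U → trans (*-congˡ (x≈0 (x∉∁p⇒x∈p v∉∁U))) (zeroʳ _)) ⟨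
      sum (λ v → A w v * x v)
        ≈⟨ rows (x∈∁p⇒x∉p (elements-∈ (∁ U) i)) ⟩
      t * x w ∎
      where w = elements (∁ U) i

  -- The combination `c * y + e * x` vanishes on `U`, hence everywhere. Agreement on `U` up to
  -- scalars is enough, so the eigenvector `x` need not be normalised.
  star-eigen : ∀ {n t} {A : Matrix n} {U : Subset n} → ¬ IsEigenvalue (delete A U) t →
    ∀ x y c e → Eigenspace A t x → ¬ c ≈ 0# →
    (∀ {w} → w ∉ U → sum (λ v → A w v * y v) ≈ t * y w) →
    (∀ {v} → v ∈ U → c * y v + e * x v ≈ 0#) → Eigenspace A t y
  star-eigen {n} {t} {A} {U} regular x y c e x-eigen c≉0 y-rows z-on-U w =
    *-cancelˡ-≉0 c≉0 (+-cancelʳ (e * (t * x w)) (c * sum (λ v → A w v * y v)) (c * (t * y w)) (begin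
      c * sum (λ v → A w v * y v) + e * (t * x w)  ≈⟨ z-row w ⟨
      sum (λ v → A w v * z v)                      ≈⟨ sum-zero {n} (λ v → trans (*-congˡ (z≈0 v)) (zeroʳ _)) ⟩
      0#                                           ≈⟨ zeroʳ t ⟨
      t * 0#                                       ≈⟨ *-congˡ (z≈0 w) ⟨
      t * z w                                      ≈⟨ t*z w ⟩
      c * (t * y w) + e * (t * x w)                ∎))
    where
    z : Vector n
    z v = c * y v + e * x v
    t*z : ∀ w → t * z w ≈ c * (t * y w) + e * (t * x w)
    t*z w = solve 5 (λ t c y e x → t :* (c :* y :+ e :* x) := c :* (t :* y) :+ e :* (t :* x)) refl
              t c (y w) e (x w)
    z-row : ∀ w → sum (λ v → A w v * z v) ≈ c * sum (λ v → A w v * y v) + e * (t * x w)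
    z-row w = trans (sum-linear (A w) y x c e) (+-congˡ (*-congˡ (x-eigen w)))
    z≈0 : ∀ v → z v ≈ 0#
    z≈0 = star-vanish regular z z-on-U λ {w} w∉U →
      trans (z-row w) (trans (+-congʳ (*-congˡ (y-rows w∉U))) (sym (t*z w)))

  -- Restricted to the points u, the basis of the eigenspace and the i-th unit
  -- vector are k + 1 vectors in ℝᵏ, hence the columns of a singular matrix once
  -- a zero row is added.
  dual-eigenvector : ∀ {n k t} {A : Matrix n} {U : Subset n} {u : Fin k → Fin n} →
    HasMultiplicity A t k → ¬ IsEigenvalue (delete A U) t → Enumerates u U → ∀ i →
    ∃ λ x → ∃ λ c → Eigenspace A t x × ¬ c ≈ 0# × x (u i) ≈ c × (∀ {j} → j ≢ i → x (u j) ≈ 0#)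
  dual-eigenvector {n} {k} {t} {A} {U} {u} multiplicity regular enumerates i
    with singular⇒null N (det-zero-row N λ _ → refl)
    where
    open HasMultiplicity multiplicity
    N : Matrix (ℕ.suc k)
    N zero    _       = 0#
    N (suc j) zero    = identity j i
    N (suc j) (suc l) = basis l (u j)
  ... | z , null , j₀ , zⱼ≉0 = x , - 1# * z zero , x-eigen , c≉0 , xᵢ , xⱼ
    where
    open HasMultiplicity multiplicity
    open Enumerates enumerates
    x : Vector n
    x = combination (z ∘ suc) basis
    x-eigen : Eigenspace A t x
    x-eigen = eigen-combination (z ∘ suc) basis inside
    value : ∀ j → x (u j) ≈ - 1# * (identity j i * z zero)
    value j = x+-1*y≈0⇒x≈y (begin
      x (u j) + - 1# * (- 1# * (identity j i * z zero))
        ≈⟨ +-cong (sum-cong-≋ {k} λ l → *-comm (z (suc l)) (basis l (u j))) (-1*-1*x≈x _) ⟩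
      sum (λ l → basis l (u j) * z (suc l)) + identity j i * z zero
        ≈⟨ +-comm _ _ ⟩
      identity j i * z zero + sum (λ l → basis l (u j) * z (suc l))
        ≈⟨ null (suc j) ⟩
      0# ∎)
    xᵢ : x (u i) ≈ - 1# * z zero
    xᵢ = trans (value i) (*-congˡ (trans (*-congʳ (reflexive (identity-≡ i))) (*-identityˡ _)))
    xⱼ : ∀ {j} → j ≢ i → x (u j) ≈ 0#
    xⱼ {j} j≢i = trans (value j)
      (trans (*-congˡ (trans (*-congʳ (reflexive (identity-≢ j≢i))) (zeroˡ _))) (zeroʳ _))
    -- If this value were zero, `x` would vanish on `U`, hence everywhere, and independence of the
    -- basis would make `z` zero.
    c≉0 : ¬ - 1# * z zero ≈ 0#
    c≉0 c≈0 = zⱼ≉0 (z≈0 j₀)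
      where
      on-U : ∀ {v} → v ∈ U → x v ≈ 0#
      on-U v∈U with Equivalence.to (image _) v∈U
      ... | j , ≡.refl with j ≟ᶠ i
      ...   | yes ≡.refl = trans xᵢ c≈0
      ...   | no  j≢i    = xⱼ j≢i
      x≈0 : ∀ v → x v ≈ 0#
      x≈0 = star-vanish regular x on-U λ {w} _ → x-eigen w
      z≈0 : ∀ j → z j ≈ 0#
      z≈0 zero    = trans (sym (-1*-1*x≈x _)) (trans (*-congˡ c≈0) (zeroʳ _))
      z≈0 (suc l) = independent (z ∘ suc) x≈0 l

  -- Path vectors of a forest.

  module Forest {n} (A : Matrix n) (A-sym : Symmetric A) (acyclic : AcyclicMatrix A) (t : ℝ) where

    open Paths (Adjacent A)

    E? = adjacent? A

    E-sym : ∀ {u v} → Adjacent A u v → Adjacent A v u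
    E-sym (u≢v , Auv≉0) = u≢v ∘ ≡.sym , λ Avu≈0 → Auv≉0 (trans (A-sym _ _) Avu≈0)

    open ForestPaths (Adjacent A) E-sym

    M : Matrix n
    M = characteristic t A

    ψ : Subset n → ℝ
    ψ = matchingSum M

    M-nonadjacent : ∀ {u v} → u ≢ v → ¬ Adjacent A u v → M u v ≈ 0#
    M-nonadjacent {u} {v} u≢v ¬uv = begin
      M u v         ≈⟨ characteristic-≢ t A u≢v ⟩
      - 1# * A u v  ≈⟨ *-congˡ (decidable-stable (A u v ≟ 0#) (¬uv ∘ (u≢v ,_))) ⟩
      - 1# * 0#     ≈⟨ zeroʳ _ ⟩
      0#            ∎

    -- The colour of a vertex tells whether `j` reaches it without passing `z`. Neighbours other
    -- than `z` share a colour, and `r` is not reached because `j` and `r` are both neighbours of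
    -- `z`.
    M-separated : Separated M
    M-separated z j r j≢z r≢z j≢r Mzj≉0 Mrz≉0 =
      reachable , dec-true (path? E? (full ∖ z) j j) (stop (x∈p∧x≢y⇒x∈p-y ∈⊤ j≢z) ≡.refl) ,
      dec-false (path? E? (full ∖ z) j r)
        (no-path-between-neighbours acyclic j≢r (adjacent (j≢z ∘ ≡.sym) Mzj≉0) (E-sym (adjacent r≢z Mrz≉0))) ,
      λ x y x≢z y≢z cx≢cy → M-nonadjacent (λ { ≡.refl → cx≢cy ≡.refl }) λ xy → cx≢cy (does-⇔
        (mk⇔ (λ p → path-snoc p xy (x∈p∧x≢y⇒x∈p-y ∈⊤ y≢z))
             (λ p → path-snoc p (E-sym xy) (x∈p∧x≢y⇒x∈p-y ∈⊤ x≢z)))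
        (path? E? (full ∖ z) j x) (path? E? (full ∖ z) j y))
      where
      reachable : Fin n → Bool
      reachable x = does (path? E? (full ∖ z) j x)
      adjacent : ∀ {u v} → u ≢ v → ¬ M u v ≈ 0# → Adjacent A u v
      adjacent {u} {v} u≢v Muv≉0 = u≢v , λ Auv≈0 → Muv≉0 (M-nonadjacent u≢v λ uv → proj₂ uv Auv≈0)

    φ≈ψ : ∀ S → φ (A [ S ]) t ≈ ψ S
    φ≈ψ S = trans (φ-principal t A S) (det≈matchingSum M M-separated S)

    weight-unique : ∀ {S u v} (p q : Path S u v) → weight A p ≈ weight A q
    weight-unique (stop _ _)        (stop _ _)      = refl
    weight-unique (stop _ ≡.refl)   (step _ _ _ q)  = contradiction (target∈ q) (x∉p∖x _)
    weight-unique (step _ _ _ p)    (stop _ ≡.refl) = contradiction (target∈ p) (x∉p∖x _)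
    weight-unique (step a _ ua p)   (step b _ ub q) with first-step-unique acyclic ua ub p q
    ... | ≡.refl = *-congˡ (weight-unique p q)

    -- The vector αᵢ of the paper for the graph induced on S, with an arbitrary
    -- set K in place of the component of the root u.
    record IsPathVector (S K : Subset n) (u : Fin n) (y : Vector n) : Set where
      field
        on-path : ∀ {v} (p : Path S u v) → y v ≈ weight A p * ψ (K ─ vertices p)
        off-path : ∀ {v} → ¬ Path S u v → y v ≈ 0#

    rooted : Subset n → Subset n → Fin n → Vector n
    rooted S K u v with path? E? S u v
    ... | yes p = weight A p * ψ (K ─ vertices p)
    ... | no  _ = 0#

    rooted-isPathVector : ∀ S K u → IsPathVector S K u (rooted S K u)
    rooted-isPathVector S K u = record { on-path = on-path ; off-path = off-path }
      where
      on-path : ∀ {v} (p : Path S u v) → rooted S K u v ≈ weight A p * ψ (K ─ vertices p)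
      on-path {v} p with path? E? S u v
      ... | yes q  = *-cong (weight-unique q p) (reflexive (≡.cong (λ V → ψ (K ─ V)) (vertices-unique acyclic q p)))
      ... | no  ¬p = contradiction p ¬p
      off-path : ∀ {v} → ¬ Path S u v → rooted S K u v ≈ 0#
      off-path {v} ¬p with path? E? S u v
      ... | yes p = contradiction p ¬p
      ... | no  _ = refl

    pathVector-isPathVector : ∀ S u → IsPathVector S (component E? S u) u (pathVector A t S u)
    pathVector-isPathVector S u = record { on-path = on-path ; off-path = off-path }
      where
      K = component E? S u
      on-path : ∀ {v} (p : Path S u v) → pathVector A t S u v ≈ weight A p * ψ (K ─ vertices p)
      on-path {v} p with path? E? S u v
      ... | yes q  = *-cong (weight-unique q p) (trans (φ≈ψ (K ─ vertices q))
                       (reflexive (≡.cong (λ V → ψ (K ─ V)) (vertices-unique acyclic q p))))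
      ... | no  ¬p = contradiction p ¬p
      off-path : ∀ {v} → ¬ Path S u v → pathVector A t S u v ≈ 0#
      off-path {v} ¬p with path? E? S u v
      ... | yes p = contradiction p ¬p
      ... | no  _ = refl

    Closed : Subset n → Subset n → Set
    Closed S K = ∀ {x z} → x ∈ K → z ∈ S → Adjacent A x z → z ∈ K

    -- Induction along the path. `K` is only asked to be closed in `S`, because this passes to
    -- `K ∖ u` in `S ∖ u`; the latter keeps the other branches at `u` and need not be the component
    -- of the next vertex.
    pathVector-row : ∀ {S K u w} (p : Path S u w) → u ≢ w → u ∈ K → K ⊆ S → Closed S K →
      ∀ {y} → IsPathVector S K u y → sum (λ v → M w v * y v) ≈ 0#
    pathVector-row (stop _ u≡w) u≢w = contradiction u≡w u≢w
    -- w is a neighbour of the root: this is the expansion of ψ (K ∖ u) at w.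
    pathVector-row {S} {K} {u} {w} (step w u∈S uw (stop w∈ ≡.refl)) u≢w u∈K K⊆S closed {y} isPV = begin
      sum f
        ≈⟨ sumOver-full K f off-K ⟩
      sumOver K f
        ≈⟨ sumOver-remove K f u∈K ⟩
      f u + sumOver T f
        ≈⟨ +-congˡ (sumOver-remove T f w∈T) ⟩
      f u + (f w + sumOver (T ∖ w) f)
        ≈⟨ +-cong root (+-cong middle (trans (sumOver-cong (T ∖ w) child)
             (sumOver-* (T ∖ w) (- 1# * A u w) (λ v → M w v * M v w * ψ (T ∖ w ∖ v))))) ⟩
      - 1# * A u w * ψ T + (M w w * (A u w * ψ (T ∖ w)) + - 1# * A u w * edgeTerms M w (T ∖ w))
        ≈⟨ solve 6 (λ m a x b y e → m :* a :* x :+ (b :* (a :* y) :+ m :* a :* e)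
                     := a :* (b :* y :+ m :* e) :+ m :* (a :* x)) refl
             (- 1#) (A u w) (ψ T) (M w w) (ψ (T ∖ w)) (edgeTerms M w (T ∖ w)) ⟩
      A u w * (M w w * ψ (T ∖ w) + - 1# * edgeTerms M w (T ∖ w)) + - 1# * (A u w * ψ T)
        ≈⟨ +-congʳ (*-congˡ (matchingSum-expand M T w∈T)) ⟨
      A u w * ψ T + - 1# * (A u w * ψ T)
        ≈⟨ x+-1*x≈0 _ ⟩
      0# ∎
      where
      open IsPathVector isPV
      f : Vector n
      f v = M w v * y v
      T = K ∖ u
      w∈S : w ∈ S
      w∈S = x∈p∖y⇒x∈p w∈
      w∈K : w ∈ K
      w∈K = closed u∈K w∈S uw
      w∈T : w ∈ T
      w∈T = x∈p∧x≢y⇒x∈p-y w∈K (u≢w ∘ ≡.sym)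
      -- A neighbour of `w` outside `K` is outside `S`, as `K` is closed, so no path reaches it.
      off-K : ∀ v → v ∉ K → f v ≈ 0#
      off-K v v∉K with E? w v
      ... | no  ¬wv = trans (*-congʳ (M-nonadjacent (λ { ≡.refl → v∉K w∈K }) ¬wv)) (zeroˡ _)
      ... | yes wv  = trans (*-congˡ (off-path λ p → v∉K (closed w∈K (target∈ p) wv))) (zeroʳ _)
      root : f u ≈ - 1# * A u w * ψ T
      root = begin
        M w u * y u
          ≈⟨ *-cong (trans (characteristic-≢ t A (u≢w ∘ ≡.sym)) (*-congˡ (A-sym w u))) (on-path (stop u∈S ≡.refl)) ⟩
        - 1# * A u w * (1# * ψ T)  ≈⟨ *-congˡ (*-identityˡ _) ⟩
        - 1# * A u w * ψ T ∎
      middle : f w ≈ M w w * (A u w * ψ (T ∖ w))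
      middle = *-congˡ (begin
        y w ≈⟨ on-path (step w u∈S uw (stop w∈ ≡.refl)) ⟩
        A u w * 1# * ψ (K ─ (⁅ u ⁆ ∪ ⁅ w ⁆))
          ≈⟨ *-cong (*-identityʳ _) (reflexive (≡.cong ψ (≡.sym (p─q─r≡p─q∪r K ⁅ u ⁆ ⁅ w ⁆)))) ⟩
        A u w * ψ (T ∖ w) ∎)
      child : ∀ {v} → v ∈ T ∖ w → f v ≈ - 1# * A u w * (M w v * M v w * ψ (T ∖ w ∖ v))
      child {v} v∈ with E? w v
      ... | no ¬wv = trans (trans (*-congʳ M≈0) (zeroˡ _))
              (sym (trans (*-congˡ (trans (*-congʳ (trans (*-congʳ M≈0) (zeroˡ _))) (zeroˡ _))) (zeroʳ _)))
        where
        M≈0 : M w v ≈ 0#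
        M≈0 = M-nonadjacent (x∈p∖y⇒x≢y v∈ ∘ ≡.sym) ¬wv
      ... | yes wv = begin
        M w v * y v
          ≈⟨ *-congˡ (on-path (step w u∈S uw (step v w∈ wv (stop v∈S∖u∖w ≡.refl)))) ⟩
        M w v * (A u w * (A w v * 1#) * ψ (K ─ (⁅ u ⁆ ∪ (⁅ w ⁆ ∪ ⁅ v ⁆))))
          ≈⟨ *-congˡ (*-cong (*-congˡ (*-identityʳ _)) (reflexive (≡.cong ψ removed))) ⟩
        M w v * (A u w * A w v * ψ (T ∖ w ∖ v))
          -- The weight contains `A w v` and the edge term `M v w`, which is its negative by
          -- symmetry; the spare sign matches that of `edgeTerms` in the expansion.
          ≈⟨ *-congˡ (*-congʳ (*-congˡ (-1*-1*x≈x _))) ⟨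
        M w v * (A u w * (- 1# * (- 1# * A w v)) * ψ (T ∖ w ∖ v))
          ≈⟨ *-congˡ (*-congʳ (*-congˡ (*-congˡ
               (trans (characteristic-≢ t A (x∈p∖y⇒x≢y v∈)) (*-congˡ (A-sym v w)))))) ⟨
        M w v * (A u w * (- 1# * M v w) * ψ (T ∖ w ∖ v))
          ≈⟨ solve 5 (λ b a m c x → b :* (a :* (m :* c) :* x) := m :* a :* (b :* c :* x)) refl
               (M w v) (A u w) (- 1#) (M v w) (ψ (T ∖ w ∖ v)) ⟩
        - 1# * A u w * (M w v * M v w * ψ (T ∖ w ∖ v)) ∎
        where
        v∈S∖u∖w : v ∈ S ∖ u ∖ w
        v∈S∖u∖w = ∖-monoˡ (∖-monoˡ K⊆S) v∈
        removed : K ─ (⁅ u ⁆ ∪ (⁅ w ⁆ ∪ ⁅ v ⁆)) ≡ T ∖ w ∖ v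
        removed = ≡.trans (≡.sym (p─q─r≡p─q∪r K ⁅ u ⁆ (⁅ w ⁆ ∪ ⁅ v ⁆))) (≡.sym (p─q─r≡p─q∪r T ⁅ w ⁆ ⁅ v ⁆))
    -- Otherwise w and its neighbours lie beyond the first step x of the path,
    -- where y is A u x times the path vector rooted at x.
    pathVector-row {S} {K} {u} {w} (step x u∈S ux p@(step _ _ _ q)) u≢w u∈K K⊆S closed {y} isPV = begin
      sum (λ v → M w v * y v)
        ≈⟨ sum-scale (A u x) {g = λ v → M w v * y′ v} term ⟩
      A u x * sum (λ v → M w v * y′ v)
        ≈⟨ *-congˡ (pathVector-row p x≢w x∈T (∖-monoˡ K⊆S) closed′ isPV′) ⟩
      A u x * 0#
        ≈⟨ zeroʳ _ ⟩
      0# ∎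
      where
      open IsPathVector isPV
      T = K ∖ u
      y′ = rooted (S ∖ u) T x
      isPV′ = rooted-isPathVector (S ∖ u) T x
      x≢w : x ≢ w
      x≢w ≡.refl = x∉p∖x _ (target∈ q)
      x∈T : x ∈ T
      x∈T = x∈p∧x≢y⇒x∈p-y (closed u∈K (x∈p∖y⇒x∈p (source∈ p)) ux) (x∈p∖y⇒x≢y (source∈ p))
      closed′ : Closed (S ∖ u) T
      closed′ a∈T b∈S∖u ab = x∈p∧x≢y⇒x∈p-y (closed (x∈p∖y⇒x∈p a∈T) (x∈p∖y⇒x∈p b∈S∖u) ab) (x∈p∖y⇒x≢y b∈S∖u)
      -- A neighbour `v` of `w` other than `u` would be reached from `x` through `w`; and `u` is not
      -- a neighbour, since the path from `x` to `w` would close to a cycle.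
      unrelated : ∀ {v} → Path S u v → ¬ Path (S ∖ u) x v → M w v ≈ 0#
      unrelated {v} r ¬q = M-nonadjacent (λ { ≡.refl → ¬q p }) λ wv → ¬wv wv (v ≟ᶠ u)
        where
        ¬wv : Adjacent A w v → ¬ Dec (v ≡ u)
        ¬wv wv (yes ≡.refl) = no-path-between-neighbours acyclic x≢w ux (E-sym wv) p
        ¬wv wv (no  v≢u)    = ¬q (path-snoc p wv (x∈p∧x≢y⇒x∈p-y (target∈ r) v≢u))
      term : ∀ v → M w v * y v ≈ A u x * (M w v * y′ v)
      term v with path? E? (S ∖ u) x v
      ... | yes r = begin
        M w v * y v
          ≈⟨ *-congˡ (on-path (step x u∈S ux r)) ⟩
        M w v * (A u x * weight A r * ψ (K ─ (⁅ u ⁆ ∪ vertices r)))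
          ≈⟨ *-congˡ (*-congˡ (reflexive (≡.cong ψ (≡.sym (p─q─r≡p─q∪r K ⁅ u ⁆ (vertices r)))))) ⟩
        M w v * (A u x * weight A r * ψ (T ─ vertices r))
          ≈⟨ solve 4 (λ m a b c → m :* (a :* b :* c) := a :* (m :* (b :* c))) refl
               (M w v) (A u x) (weight A r) (ψ (T ─ vertices r)) ⟩
        A u x * (M w v * (weight A r * ψ (T ─ vertices r))) ∎
      ... | no ¬q with path? E? S u v
      ...   | yes r = trans (trans (*-congʳ (unrelated r ¬q)) (zeroˡ _))
                        (sym (trans (*-congˡ (zeroʳ _)) (zeroʳ _)))
      ...   | no ¬r = trans (trans (*-congˡ (off-path ¬r)) (zeroʳ _))
                        (sym (trans (*-congˡ (zeroʳ _)) (zeroʳ _)))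

    ∈-component⁺ : ∀ {S u v} → Path S u v → v ∈ component E? S u
    ∈-component⁺ {S} {u} {v} p = lookup⇒[]= v _ (≡.trans (lookup∘tabulate _ v) (dec-true (path? E? S u v) p))

    ∈-component⁻ : ∀ S u {v} → v ∈ component E? S u → Path S u v
    ∈-component⁻ S u {v} v∈ = decidable-stable (path? E? S u v) λ ¬p →
      contradiction (≡.trans (≡.sym ([]=⇒lookup v∈))
        (≡.trans (lookup∘tabulate _ v) (dec-false (path? E? S u v) ¬p))) λ ()

    component-closed : ∀ S u → Closed S (component E? S u)
    component-closed S u x∈C z∈S xz = ∈-component⁺ (path-snoc (∈-component⁻ S u x∈C) xz z∈S)

    -- Path vectors rooted at the points of a star set.

    module StarSet {k : ℕ} {U : Subset n} {u : Fin k → Fin n} (multiplicity : HasMultiplicity A t k)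
                   (regular : ¬ IsEigenvalue (delete A U) t) (enumerates : Enumerates u U) where

      open Enumerates enumerates

      S : Fin k → Subset n
      S i = ∁ (U ∖ u i)

      C : Fin k → Subset n
      C i = component E? (S i) (u i)

      αᵢ : Fin k → Vector n
      αᵢ = α A t U u

      αᵢ-isPathVector : ∀ i → IsPathVector (S i) (C i) (u i) (αᵢ i)
      αᵢ-isPathVector i = pathVector-isPathVector (S i) (u i)

      u∈U : ∀ i → u i ∈ U
      u∈U i = Equivalence.from (image (u i)) (i , ≡.refl)

      u∈S : ∀ i → u i ∈ S i
      u∈S i = x∉p⇒x∈∁p (x∉p∖x U)

      u∈C : ∀ i → u i ∈ C i
      u∈C i = ∈-component⁺ (stop (u∈S i) ≡.refl)

      ∉U⇒∈S : ∀ i {w} → w ∉ U → w ∈ S i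
      ∉U⇒∈S i w∉U = x∉p⇒x∈∁p (w∉U ∘ x∈p∖y⇒x∈p)

      C∖u⊆∁U : ∀ i {v} → v ∈ C i ∖ u i → v ∉ U
      C∖u⊆∁U i v∈ v∈U =
        x∈∁p⇒x∉p (target∈ (∈-component⁻ (S i) (u i) (x∈p∖y⇒x∈p v∈))) (x∈p∧x≢y⇒x∈p-y v∈U (x∈p∖y⇒x≢y v∈))

      αᵢ-row : ∀ i {w} → w ∉ U → sum (λ v → A w v * αᵢ i v) ≈ t * αᵢ i w
      αᵢ-row i {w} w∉U = null-row⇒eigen-row t A (αᵢ i) w null
        where
        null : sum (λ v → M w v * αᵢ i v) ≈ 0#
        null with path? E? (S i) (u i) w
        ... | yes p = pathVector-row p (λ { ≡.refl → w∉U (u∈U i) }) (u∈C i)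
                        (λ v∈C → target∈ (∈-component⁻ (S i) (u i) v∈C)) (component-closed (S i) (u i))
                        (αᵢ-isPathVector i)
        -- Here `w` is outside the component of `u i` and has no neighbour in it, so every product
        -- vanishes.
        ... | no ¬p = sum-zero {n} term
          where
          term : ∀ v → M w v * αᵢ i v ≈ 0#
          term v with path? E? (S i) (u i) v
          ... | no ¬q = zeroʳ _
          ... | yes q = trans (*-congʳ (M-nonadjacent (λ { ≡.refl → ¬p q })
                          λ wv → ¬p (path-snoc q (E-sym wv) (∉U⇒∈S i w∉U)))) (zeroˡ _)

      αᵢ-off : ∀ {i j} → j ≢ i → αᵢ i (u j) ≈ 0#
      αᵢ-off {i} {j} j≢i = IsPathVector.off-path (αᵢ-isPathVector i) λ p →
        x∈∁p⇒x∉p (target∈ p) (x∈p∧x≢y⇒x∈p-y (u∈U j) (j≢i ∘ injective))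

      αᵢ-root : ∀ i → αᵢ i (u i) ≈ ψ (C i ∖ u i)
      αᵢ-root i = trans (IsPathVector.on-path (αᵢ-isPathVector i) (stop (u∈S i) ≡.refl)) (*-identityˡ _)

      -- A null vector of the block C i ∖ u i, which is a union of components of
      -- the graph of A - U, would extend by zero to an eigenvector of A - U.
      αᵢ-root≉0 : ∀ i → ¬ αᵢ i (u i) ≈ 0#
      αᵢ-root≉0 i αᵢ≈0
        with singular⇒null (M [ C i ∖ u i ])
               (trans (det≈matchingSum M M-separated (C i ∖ u i)) (trans (sym (αᵢ-root i)) αᵢ≈0))
      ... | x , null , j , xⱼ≉0 =
        xⱼ≉0 (trans (sym (extend-elements B x j)) (star-vanish regular x⁺ on-U rows (elements B j)))
        where
        B = C i ∖ u i
        x⁺ : Vector n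
        x⁺ = extend B x
        on-U : ∀ {v} → v ∈ U → x⁺ v ≈ 0#
        on-U v∈U = extend-∉ B x λ v∈B → C∖u⊆∁U i v∈B v∈U
        in-B : ∀ l → sum (λ v → M (elements B l) v * x⁺ v) ≈ 0#
        in-B l = begin
          sum (λ v → M (elements B l) v * x⁺ v)
            ≈⟨ sumOver-full B (λ v → M (elements B l) v * x⁺ v)
                 (λ v v∉B → trans (*-congˡ (extend-∉ B x v∉B)) (zeroʳ _)) ⟩
          sumOver B (λ v → M (elements B l) v * x⁺ v)
            ≈⟨ sum-cong-≋ {∣ B ∣} (λ m → *-congˡ (extend-elements B x m)) ⟩
          sum (λ m → (M [ B ]) l m * x m)
            ≈⟨ null l ⟩
          0# ∎
        rows : ∀ {w} → w ∉ U → sum (λ v → A w v * x⁺ v) ≈ t * x⁺ w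
        rows {w} w∉U = null-row⇒eigen-row t A x⁺ w row
          where
          row : sum (λ v → M w v * x⁺ v) ≈ 0#
          row with w ∈? B
          ... | yes w∈B with elements-surjective B w∈B
          ...   | l , ≡.refl = in-B l
          row | no w∉B = sum-zero {n} term
            where
            term : ∀ v → M w v * x⁺ v ≈ 0#
            term v with v ∈? B
            ... | no  _   = zeroʳ _
            ... | yes v∈B = trans (*-congʳ (M-nonadjacent (λ { ≡.refl → w∉B v∈B }) λ wv →
                    w∉B (x∈p∧x≢y⇒x∈p-y (component-closed (S i) (u i) (x∈p∖y⇒x∈p v∈B) (∉U⇒∈S i w∉U) (E-sym wv))
                                        λ { ≡.refl → w∉U (u∈U i) }))) (zeroˡ _)

      αᵢ-eigen : ∀ i → Eigenspace A t (αᵢ i)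
      αᵢ-eigen i = from-dual (dual-eigenvector multiplicity regular enumerates i)
        where
        d = αᵢ i (u i)
        from-dual : (∃ λ x → ∃ λ c → Eigenspace A t x × ¬ c ≈ 0# × x (u i) ≈ c ×
                      (∀ {j} → j ≢ i → x (u j) ≈ 0#)) →
                    Eigenspace A t (αᵢ i)
        from-dual (x , c , x-eigen , c≉0 , xᵢ , xⱼ) =
          -- Cross-multiplying by the values `c` and `d` of the two vectors at `u i` makes the
          -- combination vanish there; at the other points of `U` both vectors are zero.
          star-eigen regular x (αᵢ i) c (- 1# * d) x-eigen c≉0 (αᵢ-row i) proportional
          where
          proportional : ∀ {v} → v ∈ U → c * αᵢ i v + (- 1# * d) * x v ≈ 0#
          proportional v∈U with Equivalence.to (image _) v∈U
          ... | j , ≡.refl with j ≟ᶠ i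
          ...   | yes ≡.refl = begin
            c * d + (- 1# * d) * x (u i)  ≈⟨ +-congˡ (*-congˡ xᵢ) ⟩
            c * d + (- 1# * d) * c        ≈⟨ solve 3 (λ c d m → c :* d :+ m :* d :* c := c :* d :+ m :* (c :* d)) refl c d (- 1#) ⟩
            c * d + - 1# * (c * d)        ≈⟨ x+-1*x≈0 _ ⟩
            0# ∎
          ...   | no j≢i = begin
            c * αᵢ i (u j) + (- 1# * d) * x (u j)  ≈⟨ +-cong (*-congˡ (αᵢ-off j≢i)) (*-congˡ (xⱼ j≢i)) ⟩
            c * 0# + (- 1# * d) * 0#               ≈⟨ +-cong (zeroʳ _) (zeroʳ _) ⟩
            0# + 0#                                ≈⟨ +-identityˡ _ ⟩
            0# ∎

      α-eigenvector : ∀ i → IsEigenvector A t (αᵢ i)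
      α-eigenvector i = αᵢ-eigen i , λ αᵢ≈0 → αᵢ-root≉0 i (αᵢ≈0 (u i))

      α-independent : LinearlyIndependent αᵢ
      α-independent c combination≈0 i = cancel-≉0 (αᵢ-root≉0 i) (begin
        αᵢ i (u i) * c i             ≈⟨ *-comm _ _ ⟩
        c i * αᵢ i (u i)             ≈⟨ sum-single (λ j → c j * αᵢ j (u i)) i (λ j j≢i →
                                          trans (*-congˡ (αᵢ-off (j≢i ∘ ≡.sym))) (zeroʳ _)) ⟨
        combination c αᵢ (u i)       ≈⟨ combination≈0 (u i) ⟩
        0#                           ∎)

theorem3p8 : (R : RealNumbers) → let open Spectral R in
    (n : ℕ) (A : Matrix n) → Symmetric A → AcyclicMatrix A →
    (t : RealNumbers.ℝ R) (k : ℕ) → IsEigenvalue A t → HasMultiplicity A t k →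
    (U : Subset n) → IsStarSet A t k U →
    (u : Fin k → Fin n) → Enumerates u U →
    (∀ i → IsEigenvector A t (α A t U u i)) × LinearlyIndependent (α A t U u)
theorem3p8 R n A A-sym acyclic t k _ multiplicity U (_ , regular) u enumerates =
  α-eigenvector , α-independent
  where
  open Eigenvectors R
  open Forest A A-sym acyclic t
  open StarSet multiplicity regular enumerates
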